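{- E-E-Reach is undecidable for UCST[$Z_1^{\mathtt l},N_1^{\mathtt l}$] with write-lossy semantics. Here UCST[$Z_1^{\mathtt l},N_1^{\mathtt l}$] is the class of UCSTs in which the only tests are emptiness tests $Z$ and non-emptiness tests $N$ performed by Sender on channel $\mathtt l$.
   Context: A UCST (unidirectional channel system with tests) is a tuple $S=(\{\mathtt r,\mathtt l\},M,Q_1,\Delta_1,Q_2,\Delta_2)$ where $M$ is a finite message alphabet, $Q_1,Q_2$ are disjoint finite sets of states of Sender and Receiver respectively, and $\Delta_1,\Delta_2$ are finite sets of rules of Sender and Receiver. There are two channels: $\mathtt r$ and $\mathtt l$. A rule in $\Delta_i$ is a tuple $(q,\mathtt c,\alpha,q')\in Q_i\times\{\mathtt r,\mathtt l\}\times \mathrm{Act}\times Q_i$ with $\mathrm{Act}=\mathrm{Reg}(M)\cup M\cup\{\epsilon\}$, where $\mathrm{Reg}(M)$ is the set of regular languages over $M$ (finitely represented). If $\alpha=R\in\mathrm{Reg}(M)$ the rule is a test on $\mathtt c$; if $\alpha=x\in M\cup\{\epsilon\}$ it is a write $\mathtt c!x$ when in $\Delta_1$ and a read $\mathtt c?x$ when in $\Delta_2$ ($\alpha=\epsilon$ is the empty action). Tests: $Z=\{\epsilon\}$ and $N=M^+$. Configurations are tuples $(q_1,q_2,u,v)\in Q_1\times Q_2\times M^*\times M^*$ ($u$ is the content of $\mathtt r$, $v$ that of $\mathtt l$). Reliable steps: a rule $(q,\mathtt c,\alpha,q')$ of Sender (respectively Receiver) can be fired if $q$ is the current Sender (respectively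 Receiver) state, which becomes $q'$, the other agent's state being unchanged; a test $R$ on $\mathtt c$ requires the content of $\mathtt c$ to be in $R$ and changes no content; a write $\mathtt c!x$ appends $x$ at the right end of the content of $\mathtt c$; a read $\mathtt c?x$ requires $x$ to be a prefix of the content of $\mathtt c$ and removes it. Write-lossy semantics: a step is either a reliable step or a write-lossy step, where each Sender rule $(p,\mathtt l,x,p')$ writing $x$ on $\mathtt l$ gives rise to write-lossy steps $(p,q,u,v)\to(p',q,u,v)$ (the rule is performed but nothing is written). There are no other message losses: once in $\mathtt l$, messages are never lost. A run is a finite sequence of chained steps. E-E-Reach with write-lossy semantics: given $S$ and states $p_{\mathrm{in}},p_{\mathrm{fi}}\in Q_1$, $q_{\mathrm{in}},q_{\mathrm{fi}}\in Q_2$, is there a run, in the write-lossy semantics, from $(p_{\mathrm{in}},q_{\mathrm{in}},\epsilon,\epsilon)$ to $(p_{\mathrm{fi}},q_{\mathrm{fi}},\epsilon,\epsilon)$? -}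

module Defs where

open import Data.Fin.Base using (Fin; toℕ)
import Data.Fin.Properties as Fin
open import Data.List.Base using (List; []; _∷_; _∷ʳ_)
open import Data.List.Membership.Propositional using (_∈_; _∉_)
open import Data.List.Relation.Ternary.Appending.Propositional as Appending using ([]++_; _∷_)
open import Data.List.Relation.Unary.All using ([])
open import Data.Nat.Base using (ℕ; zero; suc; _+_; _≤_; _<_; z≤n; s≤s)
open import Data.Nat.Properties
  using (suc-injective; +-cancelˡ-≡; +-cancelʳ-≡; +-mono-≤; +-monoʳ-≤; m≤n+m; <-cmp; <⇒≢; +-comm;
         n<1+n; module ≤-Reasoning)
open import Data.Product.Base using (_×_; _,_; proj₁; proj₂; ∃-syntax)
open import Data.Sum.Base using (_⊎_; inj₁; inj₂)
open import Data.Vec.Base using (Vec; []; _∷_; lookup)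
open import Data.Vec.Relation.Binary.Pointwise.Inductive using (Pointwise)
open import Function.Bundles using (_⇔_; mk⇔; _↣_; mk↣; Injection)
open import Function.Definitions using (Injective)
open import Relation.Binary.Construct.Closure.ReflexiveTransitive using (Star)
open import Relation.Binary.Definitions using (tri<; tri≈; tri>)
open import Relation.Binary.PropositionalEquality
  using (_≡_; _≢_; refl; sym; trans; cong; cong₂)
open import Relation.Nullary using (¬_; contradiction)
import Text.Regex.Base as Regex

private
  variable
    k m n : ℕ

data Rec : ℕ → Set where
  zer  : Rec 0
  succ : Rec 1
  proj : Fin n → Rec n
  comp : Rec k → Vec (Rec n) k → Rec n
  prec : Rec n → Rec (2 + n) → Rec (1 + n)
  min  : Rec (1 + n) → Rec n

infix 4 _·_⇓_

data _·_⇓_ : Rec n → Vec ℕ n → ℕ → Set where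
  zer⇓  : zer · [] ⇓ 0
  succ⇓ : ∀ {x} → succ · x ∷ [] ⇓ suc x
  proj⇓ : ∀ {i} {xs : Vec ℕ n} → proj i · xs ⇓ lookup xs i
  comp⇓ : ∀ {f : Rec k} {gs : Vec (Rec n) k} {xs ys z} →
          Pointwise (λ g y → g · xs ⇓ y) gs ys → f · ys ⇓ z →
          comp f gs · xs ⇓ z
  prec⇓-zero : ∀ {f : Rec n} {g xs z} →
          f · xs ⇓ z →
          prec f g · 0 ∷ xs ⇓ z
  prec⇓-suc : ∀ {f : Rec n} {g x xs y z} →
          prec f g · x ∷ xs ⇓ y → g · x ∷ y ∷ xs ⇓ z →
          prec f g · suc x ∷ xs ⇓ z
  min⇓  : ∀ {f : Rec (1 + n)} {xs y} →
          (∀ i → i < y → ∃[ z ] f · i ∷ xs ⇓ suc z) → f · y ∷ xs ⇓ 0 →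
          min f · xs ⇓ y

record Problem : Set₁ where
  field
    Instance : Set
    coding   : Instance ↣ ℕ
    Yes      : Instance → Set

  code : Instance → ℕ
  code = Injection.to coding

-- Nothing is required of f on numbers that are not codes of instances in C.
-- Asking for the two implications, rather than for a disjunction, makes this
-- the weaker notion of decider, constructively, and hence undecidability the
-- stronger.

Decides : Rec 1 → (P : Problem) → (Problem.Instance P → Set) → Set
Decides f P C = ∀ I → C I →
    (Yes I   → f · code I ∷ [] ⇓ 1)
  × (¬ Yes I → f · code I ∷ [] ⇓ 0)
  where open Problem P

UndecidableOn : (P : Problem) → (Problem.Instance P → Set) → Set
UndecidableOn P C = ¬ (∃[ f ] Decides f P C)

Word : ℕ → Set
Word m = List (Fin m)

module RE {m : ℕ} = Regex (Fin.≤-preorder m)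
open RE using (ε; [_]; [^_]; _∣_; _∙_; _⋆; _─_; sum; prod; star)

-- Regular expressions over Fin m finitely represent Reg(M).

Reg : ℕ → Set
Reg m = RE.Exp {m}

Z N : Reg m
Z = ε
N = RE.· ∙ (RE.· ⋆)

data Channel : Set where
  𝚛 𝚕 : Channel

data Act (m : ℕ) : Set where
  test : Reg m → Act m
  msg  : Fin m → Act m
  ε    : Act m

Rule : ℕ → ℕ → Set
Rule m n = Fin n × Channel × Act m × Fin n

-- M = Fin #M, Q₁ = Fin #Q₁ and Q₂ = Fin #Q₂; the state sets are disjoint by
-- typing.  The lists of rules stand for the sets of their elements.

record UCST : Set where
  constructor ucst
  field
    #M #Q₁ #Q₂ : ℕ
    Δ₁         : List (Rule #M #Q₁)
    Δ₂         : List (Rule #M #Q₂)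

data Sends {m : ℕ} : Act m → Word m → Word m → Set where
  test  : ∀ {R w} → w RE.∈ R → Sends (test R) w w
  write : ∀ {x w} → Sends (msg x) w (w ∷ʳ x)
  skip  : ∀ {w} → Sends ε w w

data Receives {m : ℕ} : Act m → Word m → Word m → Set where
  test : ∀ {R w} → w RE.∈ R → Receives (test R) w w
  read : ∀ {x w} → Receives (msg x) (x ∷ w) w
  skip : ∀ {w} → Receives ε w w

Contents : ℕ → Set
Contents m = Word m × Word m

data On {m : ℕ} (_~_ : Word m → Word m → Set) : Channel → Contents m → Contents m → Set where
  on-𝚛 : ∀ {u u′ v} → u ~ u′ → On _~_ 𝚛 (u , v) (u′ , v)
  on-𝚕 : ∀ {u v v′} → v ~ v′ → On _~_ 𝚕 (u , v) (u , v′)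

module _ (S : UCST) where
  open UCST S

  Config : Set
  Config = Fin #Q₁ × Fin #Q₂ × Contents #M

  data Reliable : Config → Config → Set where
    sender   : ∀ {p p′ q c α uv uv′} →
               (p , c , α , p′) ∈ Δ₁ → On (Sends α) c uv uv′ →
               Reliable (p , q , uv) (p′ , q , uv′)
    receiver : ∀ {p q q′ c α uv uv′} →
               (q , c , α , q′) ∈ Δ₂ → On (Receives α) c uv uv′ →
               Reliable (p , q , uv) (p , q′ , uv′)

  data WriteLossy : Config → Config → Set where
    reliable : ∀ {s t} → Reliable s t → WriteLossy s t
    lose     : ∀ {p p′ q x uv} → (p , 𝚕 , msg x , p′) ∈ Δ₁ →
               WriteLossy (p , q , uv) (p′ , q , uv)

-- The tests are required to be the expressions Z and N themselves, not merely
-- expressions denoting the same languages: this gives the smallest class of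
-- presentations, so its undecidability is the strongest.

record UCST[Z₁ˡ,N₁ˡ] (S : UCST) : Set where
  open UCST S
  field
    sender-tests      : ∀ {p c R p′} → (p , c , test R , p′) ∈ Δ₁ → c ≡ 𝚕 × (R ≡ Z ⊎ R ≡ N)
    no-receiver-tests : ∀ {q c R q′} → (q , c , test R , q′) ∉ Δ₂

record Instance : Set where
  constructor inst
  field
    system    : UCST
    p-in p-fi : Fin (UCST.#Q₁ system)
    q-in q-fi : Fin (UCST.#Q₂ system)

EEReachable : Instance → Set
EEReachable (inst S p-in p-fi q-in q-fi) =
  Star (WriteLossy S) (p-in , q-in , [] , []) (p-fi , q-fi , [] , [])

∈Z : ∀ {w : Word m} → w RE.∈ Z ⇔ w ≡ []
∈Z = mk⇔ (λ { ε → refl }) (λ { refl → ε })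

∈N : ∀ {w : Word m} → w RE.∈ N ⇔ w ≢ []
∈N = mk⇔ (λ { (prod ([]++ _) () _) ; (prod (refl ∷ _) _ _) () }) from
  where
  all : (w : Word m) → w RE.∈ (RE.· ⋆)
  all []      = star (sum (inj₁ ε))
  all (x ∷ w) = star (sum (inj₂ (prod ((x ∷ []) Appending.++ w) [^ [] ] (all w))))

  from : ∀ {w : Word m} → w ≢ [] → w RE.∈ N
  from {w = []}    w≢[] = contradiction refl w≢[]
  from {w = x ∷ w} _    = prod ((x ∷ []) Appending.++ w) [^ [] ] (all w)

triangle : ℕ → ℕ
triangle zero    = 0
triangle (suc n) = suc n + triangle n

-- Cantor's pairing function

infixr 4 ⟨_,_⟩

⟨_,_⟩ : ℕ → ℕ → ℕ
⟨ x , y ⟩ = triangle (x + y) + y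

codeList : {A : Set} → (A → ℕ) → List A → ℕ
codeList code []       = 0
codeList code (x ∷ xs) = suc ⟨ code x , codeList code xs ⟩

codeRange : RE.Range {m} → ℕ
codeRange [ a ]   = ⟨ 0 , toℕ a ⟩
codeRange (a ─ b) = ⟨ 1 , ⟨ toℕ a , toℕ b ⟩ ⟩

codeReg : Reg m → ℕ
codeReg ε       = ⟨ 0 , 0 ⟩
codeReg [ rs ]  = ⟨ 1 , codeList codeRange rs ⟩
codeReg [^ rs ] = ⟨ 2 , codeList codeRange rs ⟩
codeReg (e ∣ f) = ⟨ 3 , ⟨ codeReg e , codeReg f ⟩ ⟩
codeReg (e ∙ f) = ⟨ 4 , ⟨ codeReg e , codeReg f ⟩ ⟩
codeReg (e ⋆)   = ⟨ 5 , codeReg e ⟩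

codeChannel : Channel → ℕ
codeChannel 𝚛 = 0
codeChannel 𝚕 = 1

codeAct : Act m → ℕ
codeAct (test R) = ⟨ 0 , codeReg R ⟩
codeAct (msg x)  = ⟨ 1 , toℕ x ⟩
codeAct ε        = ⟨ 2 , 0 ⟩

codeRule : Rule m n → ℕ
codeRule (q , c , α , q′) = ⟨ toℕ q , ⟨ codeChannel c , ⟨ codeAct α , toℕ q′ ⟩ ⟩ ⟩

codeInstance : Instance → ℕ
codeInstance (inst (ucst #M #Q₁ #Q₂ Δ₁ Δ₂) p-in p-fi q-in q-fi) =
  ⟨ #M , ⟨ #Q₁ , ⟨ #Q₂ , ⟨ codeList codeRule Δ₁ , ⟨ codeList codeRule Δ₂ ,
  ⟨ toℕ p-in , ⟨ toℕ p-fi , ⟨ toℕ q-in , toℕ q-fi ⟩ ⟩ ⟩ ⟩ ⟩ ⟩ ⟩ ⟩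

triangle-mono : ∀ {a b} → a ≤ b → triangle a ≤ triangle b
triangle-mono z≤n     = z≤n
triangle-mono (s≤s p) = +-mono-≤ (s≤s p) (triangle-mono p)

⟨⟩-mono-< : ∀ {x y x′ y′} → x + y < x′ + y′ → ⟨ x , y ⟩ < ⟨ x′ , y′ ⟩
⟨⟩-mono-< {x} {y} {x′} {y′} lt = begin-strict
  triangle (x + y) + y             ≤⟨ +-monoʳ-≤ (triangle (x + y)) (m≤n+m y x) ⟩
  triangle (x + y) + (x + y)       ≡⟨ +-comm (triangle (x + y)) (x + y) ⟩
  (x + y) + triangle (x + y)       <⟨ n<1+n _ ⟩
  triangle (suc (x + y))           ≤⟨ triangle-mono lt ⟩
  triangle (x′ + y′)               ≤⟨ m≤n+m _ y′ ⟩
  y′ + triangle (x′ + y′)          ≡⟨ +-comm y′ _ ⟩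
  triangle (x′ + y′) + y′          ∎
  where open ≤-Reasoning

⟨⟩-injective : ∀ {x y x′ y′} → ⟨ x , y ⟩ ≡ ⟨ x′ , y′ ⟩ → x ≡ x′ × y ≡ y′
⟨⟩-injective {x} {y} {x′} {y′} eq with <-cmp (x + y) (x′ + y′)
... | tri< lt _ _ = contradiction eq (<⇒≢ (⟨⟩-mono-< {x} {y} {x′} {y′} lt))
... | tri> _ _ gt = contradiction (sym eq) (<⇒≢ (⟨⟩-mono-< {x′} {y′} {x} {y} gt))
... | tri≈ _ s≡s′ _ = +-cancelʳ-≡ y x x′ (trans s≡s′ (cong (x′ +_) (sym y≡y′))) , y≡y′
  where
  y≡y′ : y ≡ y′
  y≡y′ = +-cancelˡ-≡ (triangle (x + y)) y y′
           (trans eq (cong (λ s → triangle s + y′) (sym s≡s′)))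

-- The arguments are explicit because they cannot be recovered by unification
-- from the numbers they are paired into.

⟨⟩-split : ∀ x y x′ y′ → ⟨ x , y ⟩ ≡ ⟨ x′ , y′ ⟩ → x ≡ x′ × y ≡ y′
⟨⟩-split x y x′ y′ eq = ⟨⟩-injective {x} {y} {x′} {y′} eq

codeList-injective : {A : Set} {code : A → ℕ} → Injective _≡_ _≡_ code →
                     Injective _≡_ _≡_ (codeList code)
codeList-injective {A} {code} inj {xs} {ys} = go xs ys
  where
  go : ∀ xs ys → codeList code xs ≡ codeList code ys → xs ≡ ys
  go []       []       _  = refl
  go (x ∷ xs) (y ∷ ys) eq =
    let (p , q) = ⟨⟩-split (code x) (codeList code xs) (code y) (codeList code ys) (suc-injective eq)
    in cong₂ _∷_ (inj p) (go xs ys q)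

codeRange-injective : Injective _≡_ _≡_ (codeRange {m})
codeRange-injective {x = [ a ]} {[ b ]} eq =
  cong [_] (Fin.toℕ-injective (proj₂ (⟨⟩-split 0 (toℕ a) 0 (toℕ b) eq)))
codeRange-injective {x = [ a ]} {b ─ c} eq
  with () ← proj₁ (⟨⟩-split 0 (toℕ a) 1 ⟨ toℕ b , toℕ c ⟩ eq)
codeRange-injective {x = a ─ b} {[ c ]} eq
  with () ← proj₁ (⟨⟩-split 1 ⟨ toℕ a , toℕ b ⟩ 0 (toℕ c) eq)
codeRange-injective {x = a ─ b} {c ─ d} eq =
  let (p , q) = ⟨⟩-split (toℕ a) (toℕ b) (toℕ c) (toℕ d)
                  (proj₂ (⟨⟩-split 1 ⟨ toℕ a , toℕ b ⟩ 1 ⟨ toℕ c , toℕ d ⟩ eq))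
  in cong₂ _─_ (Fin.toℕ-injective p) (Fin.toℕ-injective q)

private
  tagReg bodyReg : Reg m → ℕ
  tagReg ε       = 0
  tagReg [ _ ]   = 1
  tagReg [^ _ ]  = 2
  tagReg (_ ∣ _) = 3
  tagReg (_ ∙ _) = 4
  tagReg (_ ⋆)   = 5
  bodyReg ε       = 0
  bodyReg [ rs ]  = codeList codeRange rs
  bodyReg [^ rs ] = codeList codeRange rs
  bodyReg (e ∣ f) = ⟨ codeReg e , codeReg f ⟩
  bodyReg (e ∙ f) = ⟨ codeReg e , codeReg f ⟩
  bodyReg (e ⋆)   = codeReg e

  codeReg-tag : (e : Reg m) → codeReg e ≡ ⟨ tagReg e , bodyReg e ⟩
  codeReg-tag ε       = refl
  codeReg-tag [ _ ]   = refl
  codeReg-tag [^ _ ]  = refl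
  codeReg-tag (_ ∣ _) = refl
  codeReg-tag (_ ∙ _) = refl
  codeReg-tag (_ ⋆)   = refl

  reg-inj : (e f : Reg m) → codeReg e ≡ codeReg f → e ≡ f
  reg-inj′ : (e f : Reg m) → tagReg e ≡ tagReg f → bodyReg e ≡ bodyReg f → e ≡ f
  reg-inj e f eq =
    let (p , q) = ⟨⟩-split (tagReg e) (bodyReg e) (tagReg f) (bodyReg f)
                    (trans (sym (codeReg-tag e)) (trans eq (codeReg-tag f)))
    in reg-inj′ e f p q
  reg-inj′ ε       ε         refl _ = refl
  reg-inj′ [ rs ]  [ rs′ ]   refl q = cong [_] (codeList-injective codeRange-injective q)
  reg-inj′ [^ rs ] [^ rs′ ]  refl q = cong [^_] (codeList-injective codeRange-injective q)
  reg-inj′ (e ∣ f) (e′ ∣ f′) refl q =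
    let (r , s) = ⟨⟩-split (codeReg e) (codeReg f) (codeReg e′) (codeReg f′) q
    in cong₂ _∣_ (reg-inj e e′ r) (reg-inj f f′ s)
  reg-inj′ (e ∙ f) (e′ ∙ f′) refl q =
    let (r , s) = ⟨⟩-split (codeReg e) (codeReg f) (codeReg e′) (codeReg f′) q
    in cong₂ _∙_ (reg-inj e e′ r) (reg-inj f f′ s)
  reg-inj′ (e ⋆)   (e′ ⋆)    refl q = cong _⋆ (reg-inj e e′ q)

codeReg-injective : Injective _≡_ _≡_ (codeReg {m})
codeReg-injective {x = e} {f} = reg-inj e f

codeChannel-injective : Injective _≡_ _≡_ codeChannel
codeChannel-injective {𝚛} {𝚛} _ = refl
codeChannel-injective {𝚕} {𝚕} _ = refl

private
  tagAct bodyAct : Act m → ℕ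
  tagAct (test _) = 0
  tagAct (msg _)  = 1
  tagAct ε        = 2
  bodyAct (test R) = codeReg R
  bodyAct (msg x)  = toℕ x
  bodyAct ε        = 0

  codeAct-tag : (α : Act m) → codeAct α ≡ ⟨ tagAct α , bodyAct α ⟩
  codeAct-tag (test _) = refl
  codeAct-tag (msg _)  = refl
  codeAct-tag ε        = refl

  act-inj : (α β : Act m) → tagAct α ≡ tagAct β → bodyAct α ≡ bodyAct β → α ≡ β
  act-inj (test R) (test R′) refl q = cong test (codeReg-injective q)
  act-inj (msg x)  (msg x′)  refl q = cong msg (Fin.toℕ-injective q)
  act-inj ε        ε         refl _ = refl

codeAct-injective : Injective _≡_ _≡_ (codeAct {m})
codeAct-injective {x = α} {β} eq =
  let (p , q) = ⟨⟩-split (tagAct α) (bodyAct α) (tagAct β) (bodyAct β)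
                  (trans (sym (codeAct-tag α)) (trans eq (codeAct-tag β)))
  in act-inj α β p q

codeRule-injective : Injective _≡_ _≡_ (codeRule {m} {n})
codeRule-injective {x = q , c , α , q′} {y = r , d , β , r′} eq =
  let (e₁ , eq₁) = ⟨⟩-split (toℕ q) ⟨ codeChannel c , ⟨ codeAct α , toℕ q′ ⟩ ⟩
                            (toℕ r) ⟨ codeChannel d , ⟨ codeAct β , toℕ r′ ⟩ ⟩ eq
      (e₂ , eq₂) = ⟨⟩-split (codeChannel c) ⟨ codeAct α , toℕ q′ ⟩
                            (codeChannel d) ⟨ codeAct β , toℕ r′ ⟩ eq₁
      (e₃ , e₄)  = ⟨⟩-split (codeAct α) (toℕ q′) (codeAct β) (toℕ r′) eq₂
  in cong₂ _,_ (Fin.toℕ-injective e₁)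
       (cong₂ _,_ (codeChannel-injective e₂)
         (cong₂ _,_ (codeAct-injective e₃) (Fin.toℕ-injective e₄)))

codeInstance-injective : Injective _≡_ _≡_ codeInstance
codeInstance-injective
  {inst (ucst #M #Q₁ #Q₂ Δ₁ Δ₂) a b c d} {inst (ucst #M′ #Q₁′ #Q₂′ Δ₁′ Δ₂′) a′ b′ c′ d′} eq
  = go e₁ e₂ e₃ e₄ e₅ e₆ e₇ e₈ e₉
  where
  t₈ = ⟨ toℕ c , toℕ d ⟩
  t₇ = ⟨ toℕ b , t₈ ⟩
  t₆ = ⟨ toℕ a , t₇ ⟩
  t₅ = ⟨ codeList codeRule Δ₂ , t₆ ⟩
  t₄ = ⟨ codeList codeRule Δ₁ , t₅ ⟩
  t₃ = ⟨ #Q₂ , t₄ ⟩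
  t₂ = ⟨ #Q₁ , t₃ ⟩
  t₈′ = ⟨ toℕ c′ , toℕ d′ ⟩
  t₇′ = ⟨ toℕ b′ , t₈′ ⟩
  t₆′ = ⟨ toℕ a′ , t₇′ ⟩
  t₅′ = ⟨ codeList codeRule Δ₂′ , t₆′ ⟩
  t₄′ = ⟨ codeList codeRule Δ₁′ , t₅′ ⟩
  t₃′ = ⟨ #Q₂′ , t₄′ ⟩
  t₂′ = ⟨ #Q₁′ , t₃′ ⟩
  s₁ = ⟨⟩-split #M t₂ #M′ t₂′ eq
  e₁ = proj₁ s₁
  s₂ = ⟨⟩-split #Q₁ t₃ #Q₁′ t₃′ (proj₂ s₁)
  e₂ = proj₁ s₂
  s₃ = ⟨⟩-split #Q₂ t₄ #Q₂′ t₄′ (proj₂ s₂)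
  e₃ = proj₁ s₃
  s₄ = ⟨⟩-split (codeList codeRule Δ₁) t₅ (codeList codeRule Δ₁′) t₅′ (proj₂ s₃)
  e₄ = proj₁ s₄
  s₅ = ⟨⟩-split (codeList codeRule Δ₂) t₆ (codeList codeRule Δ₂′) t₆′ (proj₂ s₄)
  e₅ = proj₁ s₅
  s₆ = ⟨⟩-split (toℕ a) t₇ (toℕ a′) t₇′ (proj₂ s₅)
  e₆ = proj₁ s₆
  s₇ = ⟨⟩-split (toℕ b) t₈ (toℕ b′) t₈′ (proj₂ s₆)
  e₇ = proj₁ s₇
  s₈ = ⟨⟩-split (toℕ c) (toℕ d) (toℕ c′) (toℕ d′) (proj₂ s₇)
  e₈ = proj₁ s₈
  e₉ = proj₂ s₈

  go : #M ≡ #M′ → #Q₁ ≡ #Q₁′ → #Q₂ ≡ #Q₂′ →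
       codeList codeRule Δ₁ ≡ codeList codeRule Δ₁′ →
       codeList codeRule Δ₂ ≡ codeList codeRule Δ₂′ →
       toℕ a ≡ toℕ a′ → toℕ b ≡ toℕ b′ → toℕ c ≡ toℕ c′ → toℕ d ≡ toℕ d′ →
       inst (ucst #M #Q₁ #Q₂ Δ₁ Δ₂) a b c d ≡ inst (ucst #M′ #Q₁′ #Q₂′ Δ₁′ Δ₂′) a′ b′ c′ d′
  go refl refl refl f₄ f₅ f₆ f₇ f₈ f₉
    with refl ← codeList-injective codeRule-injective {Δ₁} {Δ₁′} f₄
       | refl ← codeList-injective codeRule-injective {Δ₂} {Δ₂′} f₅
       | refl ← Fin.toℕ-injective {i = a} {a′} f₆
       | refl ← Fin.toℕ-injective {i = b} {b′} f₇
       | refl ← Fin.toℕ-injective {i = c} {c′} f₈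
       | refl ← Fin.toℕ-injective {i = d} {d′} f₉
    = refl

EEReach-WriteLossy : Problem
EEReach-WriteLossy = record
  { Instance = Instance
  ; coding   = mk↣ codeInstance-injective
  ; Yes      = EEReachable
  }

{-# OPTIONS --safe #-}

-- Emptiness and non-emptiness tests make 𝚕 a reliable rendezvous: the Sender
-- writes x on the empty 𝚕, tests N to see that x was not lost, and tests Z to
-- see that the Receiver consumed it.  If the Receiver consumes x from 𝚕 only
-- together with an x from 𝚛, the Sender reads and writes the fifo channel 𝚛, so
-- it is a queue automaton.  A queue of unary registers computes every partial
-- recursive function.  Undecidability follows by diagonalization: given f, a
-- system computes its own code, as in a quine, runs f on it, and reaches its
-- final configuration iff the answer is 0.

module Submission where

open import Data.Fin.Base using (Fin; zero; suc; toℕ; fromℕ<; _↑ˡ_; _↑ʳ_)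
open import Data.Fin.Properties using (toℕ-fromℕ<; toℕ-injective)
open import Data.List.Base as List using (List; []; _∷_; _++_; _∷ʳ_; replicate)
open import Data.List.Membership.Propositional using (_∈_)
open import Data.List.Membership.Propositional.Properties using (∈-map⁺; ∈-map⁻; ∈-++⁺ˡ; ∈-++⁺ʳ)
open import Data.List.Properties using (++-assoc; ++-identityʳ)
open import Data.List.Relation.Binary.Subset.Propositional using (_⊆_)
open import Data.List.Relation.Unary.Any using (here; there)
open import Data.Nat.Base using (ℕ; zero; suc; _+_; _≤_; _<_; z≤n; s≤s)
open import Data.Nat.Properties
  using (<-cmp; ≤-trans; ≤-refl; ≤-reflexive; n≤1+n; m≤m+n; m≤n+m; m⊓n≤n; m≤n⇒m⊓n≡m; <⇒≤;
         +-monoʳ-≤; +-mono-≤; +-identityʳ; +-suc; m<1+n⇒m<n∨m≡n; module ≤-Reasoning)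
open import Data.Product.Base using (_×_; _,_; proj₁; proj₂; ∃-syntax)
open import Data.Sum.Base using (_⊎_; inj₁; inj₂)
open import Data.Vec.Base as Vec using (Vec; []; _∷_; lookup; map; allFin)
open import Data.Vec.Properties using (map-∘; map-cong; map-lookup-allFin; lookup-++ˡ; lookup-++ʳ; lookup-map)
open import Data.Vec.Relation.Binary.Pointwise.Inductive using (Pointwise; []; _∷_)
open import Function.Base using (id; _∘_)
open import Function.Bundles using (Equivalence)
open import Level using (0ℓ)
open import Relation.Binary.Construct.Closure.ReflexiveTransitive using (Star; ε; _◅_; _◅◅_)
open import Relation.Binary.Core using (REL; Rel)
open import Relation.Binary.Definitions using (tri<; tri≈; tri>)
open import Relation.Binary.PropositionalEquality
  using (_≡_; _≢_; refl; sym; trans; cong; cong₂; subst)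
open import Relation.Nullary using (¬_; contradiction)

open import Defs

-- The system cannot carry a description of itself that includes its own loader: the loader has one
-- rule for each unit of the number to be loaded. So `input` codes only the Sender rules other than
-- those of the loader, and everything else in the instance is fixed or recomputed from `input`.
-- This is why states have numbers that do not depend on the program, and why the number of states
-- is a crude bound that is evidently recursive in `input`. Only runs to the final configuration
-- count, so wrong guesses are harmless if they never get there. Loops may guess how often to
-- iterate, and the Receiver may fetch a letter before it is requested. Correctness is therefore
-- stated for relations between contents, not for deterministic computations.

private
  variable
    k l m n : ℕ

-- Partial recursive functions

⇓-deterministic : ∀ {f : Rec n} {xs y z} → f · xs ⇓ y → f · xs ⇓ z → y ≡ z
⇓-deterministicᵛ : ∀ {gs : Vec (Rec n) k} {xs ys zs} →
                   Pointwise (λ g y → g · xs ⇓ y) gs ys →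
                   Pointwise (λ g z → g · xs ⇓ z) gs zs → ys ≡ zs
⇓-deterministic zer⇓            zer⇓              = refl
⇓-deterministic succ⇓           succ⇓             = refl
⇓-deterministic proj⇓           proj⇓             = refl
⇓-deterministic (comp⇓ ds d)    (comp⇓ es e)
  with refl ← ⇓-deterministicᵛ ds es              = ⇓-deterministic d e
⇓-deterministic (prec⇓-zero d)  (prec⇓-zero e)    = ⇓-deterministic d e
⇓-deterministic (prec⇓-suc d d′) (prec⇓-suc e e′)
  with refl ← ⇓-deterministic d e                 = ⇓-deterministic d′ e′
-- The smaller of two distinct minima would have the value 0 by one derivation and a successor by
-- the other.
⇓-deterministic (min⇓ {y = y} below d) (min⇓ {y = z} below′ e) with <-cmp y z
... | tri< y<z _ _ with () ← ⇓-deterministic d (proj₂ (below′ y y<z))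
... | tri≈ _ y≡z _ = y≡z
... | tri> _ _ z<y with () ← ⇓-deterministic (proj₂ (below z z<y)) e
⇓-deterministicᵛ []       []       = refl
⇓-deterministicᵛ (d ∷ ds) (e ∷ es) = cong₂ _∷_ (⇓-deterministic d e) (⇓-deterministicᵛ ds es)

Recursive : (Vec ℕ n → ℕ) → Set
Recursive {n} F = ∃[ f ] ∀ (xs : Vec ℕ n) → f · xs ⇓ F xs

private
  variable
    F G : Vec ℕ n → ℕ

projʳ : (i : Fin n) → Recursive (λ xs → lookup xs i)
projʳ i = proj i , λ _ → proj⇓

comp₁ : ∀ {H : ℕ → ℕ} → Recursive {1} (λ xs → H (lookup xs zero)) → Recursive F →
        Recursive (λ xs → H (F xs))
comp₁ (h , h⇓) (f , f⇓) = comp h (f ∷ []) , λ xs → comp⇓ (f⇓ xs ∷ []) (h⇓ _)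

comp₂ : ∀ {H : ℕ → ℕ → ℕ} → Recursive {2} (λ xs → H (lookup xs zero) (lookup xs (suc zero))) →
        Recursive F → Recursive G → Recursive (λ xs → H (F xs) (G xs))
comp₂ (h , h⇓) (f , f⇓) (g , g⇓) =
  comp h (f ∷ g ∷ []) , λ xs → comp⇓ (f⇓ xs ∷ g⇓ xs ∷ []) (h⇓ _)

sucʳ : Recursive F → Recursive (λ xs → suc (F xs))
sucʳ = comp₁ (succ , λ { (_ ∷ []) → succ⇓ })

constʳ : ∀ c → Recursive {n} (λ _ → c)
constʳ zero    = comp zer [] , λ _ → comp⇓ [] zer⇓
constʳ (suc c) = sucʳ (constʳ c)

+ʳ : Recursive F → Recursive G → Recursive (λ xs → F xs + G xs)
+ʳ = comp₂ (prec (proj zero) (comp succ (proj (suc zero) ∷ [])) , λ { (x ∷ y ∷ []) → add⇓ x y })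
  where
  add⇓ : ∀ x y → prec (proj zero) (comp succ (proj (suc zero) ∷ [])) · x ∷ y ∷ [] ⇓ x + y
  add⇓ zero    y = prec⇓-zero proj⇓
  add⇓ (suc x) y = prec⇓-suc (add⇓ x y) (comp⇓ (proj⇓ ∷ []) succ⇓)

triangleʳ : Recursive F → Recursive (λ xs → triangle (F xs))
triangleʳ = comp₁ (prec zer (proj₁ next) , λ { (x ∷ []) → triangle⇓ x })
  where
  next : Recursive {2} (λ xs → suc (lookup xs zero) + lookup xs (suc zero))
  next = +ʳ (sucʳ (projʳ zero)) (projʳ (suc zero))
  triangle⇓ : ∀ x → prec zer (proj₁ next) · x ∷ [] ⇓ triangle x
  triangle⇓ zero    = prec⇓-zero zer⇓
  triangle⇓ (suc x) = prec⇓-suc (triangle⇓ x) (proj₂ next _)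

⟨⟩ʳ : Recursive F → Recursive G → Recursive (λ xs → ⟨ F xs , G xs ⟩)
⟨⟩ʳ F G = +ʳ (triangleʳ (+ʳ F G)) G

-- Queue programs

infixr 9 _⨾_

_⨾_ : {A B C : Set} → REL A B 0ℓ → REL B C 0ℓ → REL A C 0ℓ
(R ⨾ S) a c = ∃[ b ] R a b × S b c

-- There is no branching on a test: `⋆` guesses the number of iterations, and the compiled programs
-- are such that a wrong guess blocks at some `read`.
data Prog : Set where
  skip       : Prog
  write read : Fin 2 → Prog
  _∙_        : Prog → Prog → Prog
  _⋆         : Prog → Prog

infixr 6 _∙_
infix  7 _⋆

⟦_⟧ : Prog → Rel (Word 2) 0ℓ
⟦ skip ⟧    w w′ = w ≡ w′
⟦ write x ⟧ w w′ = w′ ≡ w ∷ʳ x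
⟦ read x ⟧  w w′ = w ≡ x ∷ w′
⟦ P ∙ Q ⟧        = ⟦ P ⟧ ⨾ ⟦ Q ⟧
⟦ P ⋆ ⟧          = Star ⟦ P ⟧

pattern end = zero
pattern one = suc zero

encode : Vec ℕ n → Word 2
encode []      = []
encode (x ∷ γ) = replicate x one ++ end ∷ encode γ

-- A sweep goes once through the queue, reading the old registers while it
-- writes the new ones behind them.

data Sweep : ℕ → ℕ → Set where
  done : Sweep 0 0
  keep : Sweep n m → Sweep (suc n) (suc m)
  drop : Sweep n m → Sweep (suc n) m
  zero : Sweep n m → Sweep (suc n) m
  pred : Sweep (suc n) m → Sweep (suc n) m
  new  : Sweep n m → Sweep n (suc m)
  succ : Sweep n (suc m) → Sweep n (suc m)

infix 4 _∶_↝_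

data _∶_↝_ : Sweep n m → REL (Vec ℕ n) (Vec ℕ m) 0ℓ where
  done : done ∶ [] ↝ []
  keep : ∀ {s : Sweep n m} {x γ δ} → s ∶ γ ↝ δ → keep s ∶ x ∷ γ ↝ x ∷ δ
  drop : ∀ {s : Sweep n m} {x γ δ} → s ∶ γ ↝ δ → drop s ∶ x ∷ γ ↝ δ
  zero : ∀ {s : Sweep n m} {γ δ} → s ∶ γ ↝ δ → zero s ∶ 0 ∷ γ ↝ δ
  pred : ∀ {s : Sweep (suc n) m} {x γ δ} → s ∶ x ∷ γ ↝ δ → pred s ∶ suc x ∷ γ ↝ δ
  new  : ∀ {s : Sweep n m} {γ δ} → s ∶ γ ↝ δ → new s ∶ γ ↝ 0 ∷ δ
  succ : ∀ {s : Sweep n (suc m)} {γ y δ} → s ∶ γ ↝ y ∷ δ → succ s ∶ γ ↝ suc y ∷ δ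

move : Prog
move = (read one ∙ write one) ⋆

sweepProg : Sweep n m → Prog
sweepProg done     = skip
sweepProg (keep s) = move ∙ read end ∙ write end ∙ sweepProg s
sweepProg (drop s) = read one ⋆ ∙ read end ∙ sweepProg s
sweepProg (zero s) = read end ∙ sweepProg s
sweepProg (pred s) = read one ∙ sweepProg s
sweepProg (new s)  = write end ∙ sweepProg s
sweepProg (succ s) = write one ∙ sweepProg s

private
  variable
    u v w w′ : Word 2

-- The final queue starts with `end`, which forces exactly `x` iterations: fewer leave a `one` in
-- front, and a further one would have to read `end` as `one`.
move-sound : ∀ x → ⟦ move ⟧ (replicate x one ++ end ∷ w) (end ∷ w′) → w′ ≡ w ++ replicate x one
move-sound zero    ε                         = sym (++-identityʳ _)
move-sound zero    ((_ , () , _) ◅ _)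
move-sound {w} {w′} (suc x) ((_ , refl , refl) ◅ moves) =
  trans (move-sound x (subst (λ u → ⟦ move ⟧ u (end ∷ w′)) (++-assoc (replicate x one) (end ∷ w) _) moves))
        (++-assoc w _ (replicate x one))

move-complete : ∀ x → ⟦ move ⟧ (replicate x one ++ end ∷ w) (end ∷ w ++ replicate x one)
move-complete {w} zero    = subst (λ u → ⟦ move ⟧ (end ∷ w) (end ∷ u)) (sym (++-identityʳ w)) ε
move-complete {w} (suc x) =
  (_ , refl , sym (++-assoc (replicate x one) (end ∷ w) (one ∷ []))) ◅
  subst (λ u → ⟦ move ⟧ (replicate x one ++ end ∷ w ∷ʳ one) (end ∷ u))
        (++-assoc w (one ∷ []) (replicate x one)) (move-complete x)

skip-ones-sound : ∀ x → ⟦ read one ⋆ ⟧ (replicate x one ++ end ∷ w) (end ∷ w′) → w ≡ w′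
skip-ones-sound zero    ε            = refl
skip-ones-sound (suc x) (refl ◅ rds) = skip-ones-sound x rds

skip-ones-complete : ∀ x → ⟦ read one ⋆ ⟧ (replicate x one ++ end ∷ w) (end ∷ w)
skip-ones-complete zero    = ε
skip-ones-complete (suc x) = refl ◅ skip-ones-complete x

encode-∷-++ : ∀ x (γ : Vec ℕ n) w →
              encode (x ∷ γ) ++ w ≡ replicate x one ++ end ∷ (encode γ ++ w)
encode-∷-++ x γ w = ++-assoc (replicate x one) (end ∷ encode γ) w

++-encode-∷ : ∀ w x (γ : Vec ℕ n) →
              ((w ++ replicate x one) ∷ʳ end) ++ encode γ ≡ w ++ encode (x ∷ γ)
++-encode-∷ w x γ = trans (++-assoc (w ++ replicate x one) _ _) (++-assoc w (replicate x one) _)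

-- The word `w` makes the induction go through: it is what the sweep has already written behind the
-- registers still to be read.
sweep-sound : ∀ (s : Sweep n m) {γ} → ⟦ sweepProg s ⟧ (encode γ ++ w) w′ →
              ∃[ δ ] s ∶ γ ↝ δ × w′ ≡ w ++ encode δ
sweep-sound {w = w} done {[]} refl = [] , done , sym (++-identityʳ w)
sweep-sound {w = w} (keep s) {x ∷ γ} (_ , moves , _ , refl , _ , refl , run)
  rewrite encode-∷-++ x γ w
  with refl ← move-sound x moves
  with δ , d , refl ← sweep-sound s {γ} (subst (λ u → ⟦ sweepProg s ⟧ u _)
         (trans (++-assoc (encode γ ++ w) (replicate x one) (end ∷ []))
                (++-assoc (encode γ) w (replicate x one ∷ʳ end))) run)
  = x ∷ δ , keep d ,
    trans (cong (_++ encode δ) (sym (++-assoc w (replicate x one) _))) (++-encode-∷ w x δ)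
sweep-sound {w = w} (drop s) {x ∷ γ} (_ , reads , _ , refl , run)
  rewrite encode-∷-++ x γ w
  with refl ← skip-ones-sound x reads
  with δ , d , eq ← sweep-sound s {γ} run
  = δ , drop d , eq
sweep-sound (zero s) {zero ∷ γ} (_ , refl , run)
  with δ , d , eq ← sweep-sound s {γ} run
  = δ , zero d , eq
sweep-sound (pred s) {suc x ∷ γ} (_ , refl , run)
  with δ , d , eq ← sweep-sound s {x ∷ γ} run
  = δ , pred d , eq
sweep-sound {w = w} (new s) {γ} (_ , refl , run)
  with δ , d , refl ← sweep-sound s {γ} (subst (λ u → ⟦ sweepProg s ⟧ u _) (++-assoc (encode γ) w _) run)
  = 0 ∷ δ , new d , ++-assoc w _ (encode δ)
sweep-sound {w = w} (succ s) {γ} (_ , refl , run)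
  with y ∷ δ , d , refl ← sweep-sound s {γ} (subst (λ u → ⟦ sweepProg s ⟧ u _) (++-assoc (encode γ) w _) run)
  = suc y ∷ δ , succ d , ++-assoc w _ (encode (y ∷ δ))

sweep-complete : ∀ {s : Sweep n m} {γ δ} → s ∶ γ ↝ δ →
                 ⟦ sweepProg s ⟧ (encode γ ++ w) (w ++ encode δ)
sweep-complete {w = w} done = sym (++-identityʳ w)
sweep-complete {w = w} (keep {s = s} {x} {γ} {δ} d)
  rewrite encode-∷-++ x γ w
  = _ , move-complete x , _ , refl , _ , refl ,
    subst (λ u → ⟦ sweepProg s ⟧ u (w ++ encode (x ∷ δ)))
      (sym (trans (++-assoc (encode γ ++ w) (replicate x one) (end ∷ []))
                  (++-assoc (encode γ) w (replicate x one ∷ʳ end))))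
      (subst (⟦ sweepProg s ⟧ _)
        (trans (cong (_++ encode δ) (sym (++-assoc w (replicate x one) _))) (++-encode-∷ w x δ))
        (sweep-complete d))
sweep-complete {w = w} (drop {s = s} {x} {γ} d)
  rewrite encode-∷-++ x γ w
  = _ , skip-ones-complete x , _ , refl , sweep-complete d
sweep-complete (zero d) = _ , refl , sweep-complete d
sweep-complete (pred d) = _ , refl , sweep-complete d
sweep-complete {w = w} (new {s = s} {γ} {δ} d) = _ , refl ,
  subst (λ u → ⟦ sweepProg s ⟧ u _) (sym (++-assoc (encode γ) w _))
    (subst (⟦ sweepProg s ⟧ _) (++-assoc w _ (encode δ)) (sweep-complete d))
sweep-complete {w = w} (succ {s = s} {γ} {y} {δ} d) = _ , refl ,
  subst (λ u → ⟦ sweepProg s ⟧ u _) (sym (++-assoc (encode γ) w _))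
    (subst (⟦ sweepProg s ⟧ _) (++-assoc w _ (encode (y ∷ δ))) (sweep-complete d))

-- Compilation of recursive functions

-- `sound` takes an arbitrary final content, so that in a composition nothing has to be assumed
-- about the intermediate one. A diverging computation is one that `R` relates to no result.
record Computable (R : REL (Vec ℕ n) (Vec ℕ m) 0ℓ) : Set where
  field
    prog     : Prog
    sound    : ∀ {γ w} → ⟦ prog ⟧ (encode γ) w → ∃[ δ ] R γ δ × w ≡ encode δ
    complete : ∀ {γ δ} → R γ δ → ⟦ prog ⟧ (encode γ) (encode δ)

open Computable

private
  variable
    R S : REL (Vec ℕ n) (Vec ℕ m) 0ℓ

sweep : (s : Sweep n m) → Computable (s ∶_↝_)
sweep s .prog             = sweepProg s
sweep s .sound {γ} run    = sweep-sound s (subst (λ u → ⟦ sweepProg s ⟧ u _) (sym (++-identityʳ _)) run)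
sweep s .complete {γ} d   = subst (λ u → ⟦ sweepProg s ⟧ u _) (++-identityʳ _) (sweep-complete d)

infixr 9 _then_

_then_ : Computable R → Computable S → Computable (R ⨾ S)
(c then d) .prog = c .prog ∙ d .prog
(c then d) .sound (_ , run , run′)
  with γ , r , refl ← c .sound run
  with δ , s , refl ← d .sound run′
  = δ , (γ , r , s) , refl
(c then d) .complete (γ , r , s) = encode γ , c .complete r , d .complete s

loop : {R : Rel (Vec ℕ n) 0ℓ} → Computable R → Computable (Star R)
loop c .prog = c .prog ⋆
loop {R = R} c .sound = go
  where
  go : ∀ {γ w} → Star ⟦ c .prog ⟧ (encode γ) w → ∃[ δ ] Star R γ δ × w ≡ encode δ
  go ε = _ , ε , refl
  go (run ◅ runs)
    with γ , r , refl ← c .sound run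
    with δ , rs , eq ← go runs
    = δ , r ◅ rs , eq
loop c .complete ε        = ε
loop c .complete (r ◅ rs) = c .complete r ◅ loop c .complete rs

resp : (∀ {γ δ} → R γ δ → S γ δ) → (∀ {γ δ} → S γ δ → R γ δ) → Computable R → Computable S
resp to from c .prog = c .prog
resp to from c .sound run with δ , r , eq ← c .sound run = δ , to r , eq
resp to from c .complete = c .complete ∘ from

Star-invariant : {A : Set} {T : Rel A 0ℓ} (I : A → Set) → (∀ {a b} → T a b → I a → I b) →
                 ∀ {a b} → Star T a b → I a → I b
Star-invariant I step ε        i = i
Star-invariant I step (t ◅ ts) i = Star-invariant I step ts (step t i)

-- Sweeps that act on a single register

keeps : Sweep n n
keeps {zero}  = done
keeps {suc n} = keep keeps

keeps-refl : ∀ {γ : Vec ℕ n} → keeps ∶ γ ↝ γ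
keeps-refl {γ = []}    = done
keeps-refl {γ = x ∷ γ} = keep keeps-refl

keeps-≡ : ∀ {γ δ : Vec ℕ n} → keeps ∶ γ ↝ δ → γ ≡ δ
keeps-≡ {γ = []}    done     = refl
keeps-≡ {γ = x ∷ γ} (keep d) = cong (x ∷_) (keeps-≡ d)

bump : Fin n → Vec ℕ n → Vec ℕ n
bump zero    (x ∷ γ) = suc x ∷ γ
bump (suc i) (x ∷ γ) = x ∷ bump i γ

sweepAt : (∀ {n} → Sweep (suc n) (suc n)) → Fin n → Sweep n n
sweepAt s zero    = s
sweepAt s (suc i) = keep (sweepAt s i)

-- In `zeroAt`, `new` writes back the empty register that `zero` consumes, which makes it a pure
-- test.
incAt decAt zeroAt : Fin n → Sweep n n
incAt  = sweepAt (succ keeps)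
decAt  = sweepAt (pred keeps)
zeroAt = sweepAt (new (zero keeps))

incAt-≡ : ∀ (i : Fin n) {γ δ} → incAt i ∶ γ ↝ δ → δ ≡ bump i γ
incAt-≡ zero    (succ (keep d)) = cong (_ ∷_) (sym (keeps-≡ d))
incAt-≡ (suc i) (keep d)        = cong (_ ∷_) (incAt-≡ i d)

incAt-bump : ∀ (i : Fin n) {γ} → incAt i ∶ γ ↝ bump i γ
incAt-bump zero    {x ∷ γ} = succ keeps-refl
incAt-bump (suc i) {x ∷ γ} = keep (incAt-bump i)

decAt-≡ : ∀ (i : Fin n) {γ δ} → decAt i ∶ γ ↝ δ → γ ≡ bump i δ
decAt-≡ zero    (pred (keep d)) = cong (_ ∷_) (keeps-≡ d)
decAt-≡ (suc i) (keep d)        = cong (_ ∷_) (decAt-≡ i d)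

decAt-bump : ∀ (i : Fin n) {γ} → decAt i ∶ bump i γ ↝ γ
decAt-bump zero    {x ∷ γ} = pred keeps-refl
decAt-bump (suc i) {x ∷ γ} = keep (decAt-bump i)

zeroAt-≡ : ∀ (i : Fin n) {γ δ} → zeroAt i ∶ γ ↝ δ → γ ≡ δ × lookup γ i ≡ 0
zeroAt-≡ zero    (new (zero d)) = cong (0 ∷_) (keeps-≡ d) , refl
zeroAt-≡ (suc i) (keep d)       = let (eq , z) = zeroAt-≡ i d in cong (_ ∷_) eq , z

zeroAt-refl : ∀ (i : Fin n) {γ} → lookup γ i ≡ 0 → zeroAt i ∶ γ ↝ γ
zeroAt-refl zero    {zero ∷ γ} refl = new (zero keeps-refl)
zeroAt-refl (suc i) {x ∷ γ}    eq   = keep (zeroAt-refl i eq)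

bumps : Fin n → ℕ → Vec ℕ n → Vec ℕ n
bumps i zero    γ = γ
bumps i (suc t) γ = bumps i t (bump i γ)

lookup-bump : ∀ (i : Fin n) γ → lookup (bump i γ) i ≡ suc (lookup γ i)
lookup-bump zero    (x ∷ γ) = refl
lookup-bump (suc i) (x ∷ γ) = lookup-bump i γ

lookup-bumps : ∀ (i : Fin n) t γ → lookup (bumps i t γ) i ≡ t + lookup γ i
lookup-bumps i zero    γ = refl
lookup-bumps i (suc t) γ =
  trans (lookup-bumps i t (bump i γ)) (trans (cong (t +_) (lookup-bump i γ)) (+-suc t _))

unbump : ∀ (i : Fin n) γ {x} → lookup γ i ≡ suc x → ∃[ γ′ ] bump i γ′ ≡ γ × lookup γ′ i ≡ x
unbump zero    (suc x ∷ γ) refl = x ∷ γ , refl , refl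
unbump (suc i) (y ∷ γ)     eq   =
  let (γ′ , b , eq′) = unbump i γ eq in y ∷ γ′ , cong (y ∷_) b , eq′

unbumps : ∀ (i : Fin n) x γ → lookup γ i ≡ x → ∃[ γ′ ] bumps i x γ′ ≡ γ × lookup γ′ i ≡ 0
unbumps i zero    γ eq = γ , refl , eq
unbumps i (suc x) γ eq
  with γ₁ , refl , eq₁ ← unbump i γ eq
  with γ₂ , refl , eq₂ ← unbumps i x γ₁ eq₁
  = γ₂ , bumps-bump x γ₂ , eq₂
  where
  bumps-bump : ∀ t γ → bumps i t (bump i γ) ≡ bump i (bumps i t γ)
  bumps-bump zero    γ = refl
  bumps-bump (suc t) γ = bumps-bump t (bump i γ)

-- The register i is emptied into two fresh ones, of which one refills it.

copy : (i : Fin n) → Computable (λ γ δ → δ ≡ lookup γ i ∷ γ)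
copy {n} i = resp {R = Copying} to from
  -- The sweep after each loop tests the register that the loop empties, so neither loop can be left
  -- early.
  (sweep (new (new keeps)) then loop (sweep split) then sweep (keep (keep (zeroAt i))) then
   loop (sweep refill) then sweep (zero keeps))
  where
  split refill : Sweep (2 + n) (2 + n)
  split  = succ (keep (succ (keep (decAt i))))
  refill = pred (keep (keep (incAt i)))

  Split Refill : ℕ → Vec ℕ n → Vec ℕ (2 + n) → Set
  Split  _ γ (b ∷ a ∷ γ′) = b ≡ a × bumps i a γ′ ≡ γ
  Refill a γ (b ∷ a′ ∷ γ′) = a′ ≡ a × bumps i b γ′ ≡ γ

  split-step : ∀ {γ β β′} → split ∶ β ↝ β′ → Split 0 γ β → Split 0 γ β′
  split-step {β = b ∷ _} (succ (keep (succ (keep d)))) (refl , eq) =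
    refl , trans (cong (bumps i b) (sym (decAt-≡ i d))) eq

  refill-step : ∀ {a γ β β′} → refill ∶ β ↝ β′ → Refill a γ β → Refill a γ β′
  refill-step {β′ = b ∷ _} (pred (keep (keep d))) (refl , eq) =
    refl , trans (cong (bumps i b) (incAt-≡ i d)) eq

  split-all : ∀ t γ → Star (split ∶_↝_) (0 ∷ 0 ∷ bumps i t γ) (t ∷ t ∷ γ)
  split-all zero    γ = ε
  split-all (suc t) γ =
    split-all t (bump i γ) ◅◅ succ (keep (succ (keep (decAt-bump i)))) ◅ ε

  refill-all : ∀ t a γ → Star (refill ∶_↝_) (t ∷ a ∷ γ) (0 ∷ a ∷ bumps i t γ)
  refill-all zero    a γ = ε
  refill-all (suc t) a γ = pred (keep (keep (incAt-bump i))) ◅ refill-all t a (bump i γ)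

  Copying : REL (Vec ℕ n) (Vec ℕ (suc n)) 0ℓ
  Copying = (new (new keeps) ∶_↝_) ⨾ Star (split ∶_↝_) ⨾ (keep (keep (zeroAt i)) ∶_↝_) ⨾
            Star (refill ∶_↝_) ⨾ (zero keeps ∶_↝_)

  to : ∀ {γ δ} → Copying γ δ → δ ≡ lookup γ i ∷ γ
  to {γ} (_ , new (new d) , b ∷ a ∷ γ₁ , splits , _ , keep (keep z) , _ , refills , zero (keep d′))
    with refl ← keeps-≡ d
    with refl , eq ← Star-invariant (Split 0 γ) split-step splits (refl , refl)
    with refl , z₀ ← zeroAt-≡ i z
    with refl , refl ← Star-invariant (Refill a γ) refill-step refills (refl , eq)
    = cong₂ _∷_
        (sym (trans (cong (λ γ → lookup γ i) (sym eq))
             (trans (lookup-bumps i a γ₁) (trans (cong (a +_) z₀) (+-identityʳ a)))))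
        (sym (keeps-≡ d′))

  from : ∀ {γ δ} → δ ≡ lookup γ i ∷ γ → Copying γ δ
  from {γ} refl
    with lookup γ i in eq
  ... | x with γ₁ , refl , z₀ ← unbumps i x γ eq
    = _ , new (new keeps-refl) , _ , split-all x γ₁ , _ , keep (keep (zeroAt-refl i z₀)) ,
      _ , refill-all x x γ₁ , zero keeps-refl

-- A stack discipline: `γ` survives and the result is pushed in front of it. The arguments stay
-- where they are and are named by `ρ`; a push only shifts the names.
Result : Rec n → Vec (Fin l) n → REL (Vec ℕ l) (Vec ℕ (suc l)) 0ℓ
Result f ρ γ δ = ∃[ z ] f · map (lookup γ) ρ ⇓ z × δ ≡ z ∷ γ

Results : Vec (Rec n) k → Vec (Fin l) n → REL (Vec ℕ l) (Vec ℕ (k + l)) 0ℓ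
Results gs ρ γ δ = ∃[ ys ] Pointwise (λ g y → g · map (lookup γ) ρ ⇓ y) gs ys × δ ≡ ys Vec.++ γ

lookup-weaken : ∀ (ys : Vec ℕ k) (γ : Vec ℕ l) (ρ : Vec (Fin l) n) →
                map (lookup (ys Vec.++ γ)) (map (k ↑ʳ_) ρ) ≡ map (lookup γ) ρ
lookup-weaken ys γ ρ = trans (sym (map-∘ _ _ ρ)) (map-cong (lookup-++ʳ ys γ) ρ)

lookup-results : ∀ (ys : Vec ℕ k) (γ : Vec ℕ l) →
                 map (lookup (ys Vec.++ γ)) (map (_↑ˡ l) (allFin k)) ≡ ys
lookup-results {k} ys γ =
  trans (sym (map-∘ _ _ (allFin k)))
        (trans (map-cong (lookup-++ˡ ys γ) (allFin k)) (map-lookup-allFin ys))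

drops : ∀ k → Sweep (k + n) n
drops zero    = keeps
drops (suc k) = drop (drops k)

drops-≡ : ∀ (ys : Vec ℕ k) {γ δ : Vec ℕ n} → drops k ∶ ys Vec.++ γ ↝ δ → γ ≡ δ
drops-≡ []       d        = keeps-≡ d
drops-≡ (y ∷ ys) (drop d) = drops-≡ ys d

drops-++ : ∀ (ys : Vec ℕ k) {γ : Vec ℕ n} → drops k ∶ ys Vec.++ γ ↝ γ
drops-++ []       = keeps-refl
drops-++ (y ∷ ys) = drop (drops-++ ys)

compile : (f : Rec n) (ρ : Vec (Fin l) n) → Computable (Result f ρ)
compileAll : (gs : Vec (Rec n) k) (ρ : Vec (Fin l) n) → Computable (Results gs ρ)

compile zer [] = resp
  (λ { (new d) → 0 , zer⇓ , cong (0 ∷_) (sym (keeps-≡ d)) })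
  (λ { (_ , zer⇓ , refl) → new keeps-refl })
  (sweep (new keeps))
compile succ (i ∷ []) = resp
  (λ { (_ , refl , succ (keep d)) → _ , succ⇓ , cong (_ ∷_) (sym (keeps-≡ d)) })
  (λ { (_ , succ⇓ , refl) → _ , refl , succ keeps-refl })
  (copy i then sweep (succ keeps))
compile (proj j) ρ = resp
  (λ { {γ} refl → _ , proj⇓ , cong (_∷ γ) (sym (lookup-map j (lookup γ) ρ)) })
  (λ { {γ} (_ , proj⇓ , refl) → cong (_∷ γ) (lookup-map j (lookup γ) ρ) })
  (copy (lookup ρ j))
compile (comp {k = k} f gs) ρ = resp
  (λ { {γ} (_ , (ys , ds , refl) , _ , (z , d , refl) , keep d′) →
       z , comp⇓ ds (subst (f ·_⇓ z) (lookup-results ys γ) d) , cong (z ∷_) (sym (drops-≡ ys d′)) })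
  (λ { {γ} (z , comp⇓ {ys = ys} ds d , refl) →
       _ , (ys , ds , refl) , _ , (z , subst (f ·_⇓ z) (sym (lookup-results ys γ)) d , refl) ,
       keep (drops-++ ys) })
  (compileAll gs ρ then compile f (map (_↑ˡ _) (allFin k)) then sweep (keep (drops k)))
compile {l = l} (prec {n = n} f g) (r ∷ ρ) = resp {R = Whole} to from
  (copy r then sweep (new keeps) then compile f (map (2 ↑ʳ_) ρ) then
   loop (compile g ρ′ then sweep advance) then sweep (keep (drop (zero keeps))))
  where
  -- The loop works on `y ∷ i ∷ c ∷ γ`, where `y` is the value at `i` and `c` iterations remain; the
  -- last sweep can be performed only with `c` equal to 0.
  ρ′ : Vec (Fin (3 + l)) (2 + n)
  ρ′ = suc zero ∷ zero ∷ map (3 ↑ʳ_) ρ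

  advance : Sweep (4 + l) (3 + l)
  advance = keep (drop (succ (keep (pred keeps))))

  Body : Rel (Vec ℕ (3 + l)) 0ℓ
  Body = Result g ρ′ ⨾ (advance ∶_↝_)

  Whole : REL (Vec ℕ l) (Vec ℕ (suc l)) 0ℓ
  Whole = (λ γ δ → δ ≡ lookup γ r ∷ γ) ⨾ (new keeps ∶_↝_) ⨾ Result f (map (2 ↑ʳ_) ρ) ⨾
          Star Body ⨾ (keep (drop (zero keeps)) ∶_↝_)

  Invariant : Vec ℕ l → Vec ℕ (3 + l) → Set
  Invariant γ (y ∷ i ∷ c ∷ γ′) =
    prec f g · i ∷ map (lookup γ) ρ ⇓ y × i + c ≡ lookup γ r × γ′ ≡ γ

  step : ∀ {γ β β′} → Body β β′ → Invariant γ β → Invariant γ β′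
  step {γ} {y ∷ i ∷ suc c ∷ _} (_ , (z , d , refl) , keep (drop (succ (keep (pred (keep d′)))))) (e , eq , refl) =
    prec⇓-suc e (subst (λ xs → g · i ∷ y ∷ xs ⇓ z) (lookup-weaken (y ∷ i ∷ suc c ∷ []) γ ρ) d) ,
    trans (sym (+-suc i c)) eq , sym (keeps-≡ d′)

  to : ∀ {γ δ} → Whole γ δ → Result (prec f g) (r ∷ ρ) γ δ
  to {γ} (_ , refl , _ , new d₀ , _ , (y₀ , d , refl) , _ ∷ i ∷ _ ∷ _ , steps , keep (drop (zero d₁)))
    with refl ← keeps-≡ d₀
    with e , eq , refl ← Star-invariant (Invariant γ) step steps
      (prec⇓-zero (subst (f ·_⇓ y₀) (lookup-weaken (0 ∷ lookup γ r ∷ []) γ ρ) d) , refl , refl)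
    = _ , subst (λ i → prec f g · i ∷ _ ⇓ _) (trans (sym (+-identityʳ i)) eq) e ,
      cong (_ ∷_) (sym (keeps-≡ d₁))

  -- The extra count `c` stands for the iterations still to come. The derivation exposes the last
  -- iteration first, so the recursive call leaves `suc c`.
  iterate : ∀ γ {x z} → prec f g · x ∷ map (lookup γ) ρ ⇓ z → ∀ c →
            ∃[ y₀ ] f · map (lookup γ) ρ ⇓ y₀ ×
                    Star Body (y₀ ∷ 0 ∷ x + c ∷ γ) (z ∷ x ∷ c ∷ γ)
  iterate γ (prec⇓-zero d) c = _ , d , ε
  iterate γ {suc x} {z} (prec⇓-suc {y = y} e d) c
    with y₀ , d₀ , steps ← iterate γ e (suc c)
    = y₀ , d₀ , subst (λ t → Star Body (y₀ ∷ 0 ∷ t ∷ γ) (y ∷ x ∷ suc c ∷ γ)) (+-suc x c) steps ◅◅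
      (_ , (z , subst (λ xs → g · x ∷ y ∷ xs ⇓ z) (sym (lookup-weaken (y ∷ x ∷ suc c ∷ []) γ ρ)) d , refl) ,
       keep (drop (succ (keep (pred keeps-refl))))) ◅ ε

  from : ∀ {γ δ} → Result (prec f g) (r ∷ ρ) γ δ → Whole γ δ
  from {γ} (z , e , refl)
    with y₀ , d , steps ← iterate γ e 0
    = _ , refl , _ , new keeps-refl ,
      _ , (y₀ , subst (f ·_⇓ y₀) (sym (lookup-weaken (0 ∷ lookup γ r ∷ []) γ ρ)) d , refl) ,
      _ , subst (λ t → Star Body (y₀ ∷ 0 ∷ t ∷ γ) (z ∷ lookup γ r ∷ 0 ∷ γ)) (+-identityʳ _) steps ,
      keep (drop (zero keeps-refl))
compile {l = l} (min {n = n} f) ρ = resp {R = Whole} to from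
  (sweep (new keeps) then loop (compile f ρ′ then sweep advance then sweep (drop keeps)) then
   compile f ρ′ then sweep (zero keeps))
  where
  ρ′ : Vec (Fin (1 + l)) (1 + n)
  ρ′ = zero ∷ map (1 ↑ʳ_) ρ

  -- `pred` acts on the value of `f` and thereby tests that it is positive; what remains of the
  -- value is dropped afterwards.
  advance : Sweep (2 + l) (2 + l)
  advance = pred (keep (succ keeps))

  Body : Rel (Vec ℕ (1 + l)) 0ℓ
  Body = Result f ρ′ ⨾ (advance ∶_↝_) ⨾ (drop keeps ∶_↝_)

  Whole : REL (Vec ℕ l) (Vec ℕ (suc l)) 0ℓ
  Whole = (new keeps ∶_↝_) ⨾ Star Body ⨾ Result f ρ′ ⨾ (zero keeps ∶_↝_)

  Positive : Vec ℕ l → ℕ → Set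
  Positive γ y = ∀ i → i < y → ∃[ z ] f · i ∷ map (lookup γ) ρ ⇓ suc z

  Invariant : Vec ℕ l → Vec ℕ (1 + l) → Set
  Invariant γ (y ∷ γ′) = Positive γ y × γ′ ≡ γ

  extend : ∀ {γ y z} → f · y ∷ map (lookup γ) ρ ⇓ suc z → Positive γ y → Positive γ (suc y)
  extend d below i i<1+y with m<1+n⇒m<n∨m≡n i<1+y
  ... | inj₁ i<y  = below i i<y
  ... | inj₂ refl = _ , d

  step : ∀ {γ β β′} → Body β β′ → Invariant γ β → Invariant γ β′
  step {γ} {y ∷ _} (_ , (suc z , d , refl) , _ , pred (keep (succ (keep d₁))) , drop (keep d₂)) (below , refl)
    with refl ← keeps-≡ d₁ | refl ← keeps-≡ d₂
    = extend {γ} (subst (λ xs → f · y ∷ xs ⇓ suc z) (lookup-weaken (y ∷ []) γ ρ) d) below , refl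

  to : ∀ {γ δ} → Whole γ δ → Result (min f) ρ γ δ
  to {γ} (_ , new d₀ , y ∷ _ , steps , _ , (_ , d , refl) , zero (keep d₁))
    with refl ← keeps-≡ d₀
    with below , refl ← Star-invariant (Invariant γ) step steps ((λ _ ()) , refl)
    = y , min⇓ below (subst (λ xs → f · y ∷ xs ⇓ 0) (lookup-weaken (y ∷ []) γ ρ) d) ,
      cong (y ∷_) (sym (keeps-≡ d₁))

  search : ∀ γ y → Positive γ y → Star Body (0 ∷ γ) (y ∷ γ)
  search γ zero    below = ε
  search γ (suc y) below with z , d ← below y ≤-refl =
    search γ y (λ i i<y → below i (≤-trans i<y (n≤1+n y))) ◅◅
    (_ , (suc z , subst (λ xs → f · y ∷ xs ⇓ suc z) (sym (lookup-weaken (y ∷ []) γ ρ)) d , refl) ,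
     _ , pred (keep (succ keeps-refl)) , drop keeps-refl) ◅ ε

  from : ∀ {γ δ} → Result (min f) ρ γ δ → Whole γ δ
  from {γ} (y , min⇓ below d , refl) =
    _ , new keeps-refl , _ , search γ y below ,
    _ , (0 , subst (λ xs → f · y ∷ xs ⇓ 0) (sym (lookup-weaken (y ∷ []) γ ρ)) d , refl) ,
    zero keeps-refl

compileAll [] ρ = resp
  (λ d → [] , [] , sym (keeps-≡ d))
  (λ { ([] , [] , refl) → keeps-refl })
  (sweep keeps)
compileAll {k = suc k} (g ∷ gs) ρ = resp
  (λ { {γ} (_ , (ys , ds , refl) , y , d , refl) →
       y ∷ ys , subst (g ·_⇓ y) (lookup-weaken ys γ ρ) d ∷ ds , refl })
  (λ { {γ} (y ∷ ys , d ∷ ds , refl) →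
       _ , (ys , ds , refl) , y , subst (g ·_⇓ y) (sym (lookup-weaken ys γ ρ)) d , refl })
  -- Evaluating the tail first leaves the pushed results in the order of `gs`.
  (compileAll gs ρ then compile g (map (k ↑ʳ_) ρ))

-- The target has no registers, hence the empty queue as its encoding: E-E-reachability asks for
-- empty channels at the end. The last sweep blocks unless the result is 0.
vanishing : (h : Rec 1) → Computable {1} {0} (λ γ _ → h · γ ⇓ 0)
vanishing h = resp
  (λ { {x ∷ []} (_ , (_ , d , refl) , zero (drop done)) → d })
  (λ { {x ∷ []} {[]} d → _ , (0 , d , refl) , zero (drop done) })
  (compile h (zero ∷ []) then sweep (zero (drop done)))

-- Numbering the control states

x≤⟨x,y⟩ : ∀ x y → x ≤ ⟨ x , y ⟩
x≤⟨x,y⟩ x y = begin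
  x                    ≤⟨ m≤m+n x y ⟩
  x + y                ≤⟨ n≤triangle (x + y) ⟩
  triangle (x + y)     ≤⟨ m≤m+n _ y ⟩
  triangle (x + y) + y ∎
  where
  open ≤-Reasoning
  n≤triangle : ∀ n → n ≤ triangle n
  n≤triangle zero    = z≤n
  n≤triangle (suc n) = m≤m+n (suc n) (triangle n)

y≤⟨x,y⟩ : ∀ x y → y ≤ ⟨ x , y ⟩
y≤⟨x,y⟩ x y = m≤n+m y (triangle (x + y))

⟨⟩-monoʳ-≤ : ∀ x {y z} → y ≤ z → ⟨ x , y ⟩ ≤ ⟨ x , z ⟩
⟨⟩-monoʳ-≤ x y≤z = +-mono-≤ (triangle-mono (+-monoʳ-≤ x y≤z)) y≤z

codeProg : Prog → ℕ
codeProg skip      = ⟨ 0 , 0 ⟩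
codeProg (write x) = ⟨ 1 , toℕ x ⟩
codeProg (read x)  = ⟨ 2 , toℕ x ⟩
codeProg (P ∙ Q)   = ⟨ 3 , ⟨ codeProg P , codeProg Q ⟩ ⟩
codeProg (P ⋆)     = ⟨ 4 , codeProg P ⟩

private
  tagProg bodyProg : Prog → ℕ
  tagProg skip      = 0
  tagProg (write _) = 1
  tagProg (read _)  = 2
  tagProg (_ ∙ _)   = 3
  tagProg (_ ⋆)     = 4
  bodyProg skip      = 0
  bodyProg (write x) = toℕ x
  bodyProg (read x)  = toℕ x
  bodyProg (P ∙ Q)   = ⟨ codeProg P , codeProg Q ⟩
  bodyProg (P ⋆)     = codeProg P

  codeProg-tag : ∀ P → codeProg P ≡ ⟨ tagProg P , bodyProg P ⟩
  codeProg-tag skip      = refl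
  codeProg-tag (write _) = refl
  codeProg-tag (read _)  = refl
  codeProg-tag (_ ∙ _)   = refl
  codeProg-tag (_ ⋆)     = refl

  codeProg-inj : ∀ P Q → codeProg P ≡ codeProg Q → P ≡ Q
  codeProg-inj′ : ∀ P Q → tagProg P ≡ tagProg Q → bodyProg P ≡ bodyProg Q → P ≡ Q
  codeProg-inj P Q eq =
    let (t , b) = ⟨⟩-split (tagProg P) (bodyProg P) (tagProg Q) (bodyProg Q)
                    (trans (sym (codeProg-tag P)) (trans eq (codeProg-tag Q)))
    in codeProg-inj′ P Q t b
  codeProg-inj′ skip      skip      refl _  = refl
  codeProg-inj′ (write x) (write y) refl eq = cong write (toℕ-injective eq)
  codeProg-inj′ (read x)  (read y)  refl eq = cong read (toℕ-injective eq)
  codeProg-inj′ (P ∙ P′)  (Q ∙ Q′)  refl eq =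
    let (e , e′) = ⟨⟩-split (codeProg P) (codeProg P′) (codeProg Q) (codeProg Q′) eq
    in cong₂ _∙_ (codeProg-inj P Q e) (codeProg-inj P′ Q′ e′)
  codeProg-inj′ (P ⋆)     (Q ⋆)     refl eq = cong _⋆ (codeProg-inj P Q eq)

-- In state at K the Sender still has to perform the programs in K.  It reads x
-- from 𝚛 by sending x to the Receiver, passing through sent x and seen x, and
-- in state load i it has i more ones of its input to write.

data State : Set where
  at        : List Prog → State
  load      : ℕ → State
  sent seen : Fin 2 → List Prog → State

codeCont : List Prog → ℕ
codeCont = codeList codeProg

-- One numbering serves all programs. In particular `load i` is `⟨ 1 , i ⟩` and the final state
-- `at []` is 0, whatever the program.
tag body number : State → ℕ
tag (at _)      = 0
tag (load _)    = 1
tag (sent _ _)  = 2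
tag (seen _ _)  = 3
body (at K)     = codeCont K
body (load i)   = i
body (sent x K) = ⟨ toℕ x , codeCont K ⟩
body (seen x K) = ⟨ toℕ x , codeCont K ⟩
number σ        = ⟨ tag σ , body σ ⟩

codeCont-injective : ∀ {K L} → codeCont K ≡ codeCont L → K ≡ L
codeCont-injective = codeList-injective (codeProg-inj _ _)

number-injective : ∀ {σ τ} → number σ ≡ number τ → σ ≡ τ
number-injective {σ} {τ} eq = go σ τ (proj₁ parts) (proj₂ parts)
  where
  parts = ⟨⟩-split (tag σ) (body σ) (tag τ) (body τ) eq
  go : ∀ σ τ → tag σ ≡ tag τ → body σ ≡ body τ → σ ≡ τ
  go (at K)     (at L)     refl eq = cong at (codeCont-injective eq)
  go (load i)   (load j)   refl eq = cong load eq
  go (sent x K) (sent y L) refl eq =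
    let (e , e′) = ⟨⟩-split (toℕ x) (codeCont K) (toℕ y) (codeCont L) eq
    in cong₂ sent (toℕ-injective e) (codeCont-injective e′)
  go (seen x K) (seen y L) refl eq =
    let (e , e′) = ⟨⟩-split (toℕ x) (codeCont K) (toℕ y) (codeCont L) eq
    in cong₂ seen (toℕ-injective e) (codeCont-injective e′)

-- The simulating system

-- State zero is idle; state suc x holds an x taken from 𝚛 for which the request
-- on 𝚕 has not been consumed yet.

data ReceiverRule : Rule 2 3 → Set where
  fetch   : ∀ x → ReceiverRule (zero , 𝚛 , msg x , suc x)
  confirm : ∀ x → ReceiverRule (suc x , 𝚕 , msg x , zero)

-- The codes of concrete rules are numerals too large to be evaluated, hence
-- the opaque definitions.

opaque
  receiverRules : List (Rule 2 3)
  receiverRules =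
    (zero , 𝚛 , msg end , suc end) ∷ (suc end , 𝚕 , msg end , zero) ∷
    (zero , 𝚛 , msg one , suc one) ∷ (suc one , 𝚕 , msg one , zero) ∷ []

  ReceiverRule⇒∈ : ∀ {r} → ReceiverRule r → r ∈ receiverRules
  ReceiverRule⇒∈ (fetch end)   = here refl
  ReceiverRule⇒∈ (confirm end) = there (here refl)
  ReceiverRule⇒∈ (fetch one)   = there (there (here refl))
  ReceiverRule⇒∈ (confirm one) = there (there (there (here refl)))

  ∈⇒ReceiverRule : ∀ {r} → r ∈ receiverRules → ReceiverRule r
  ∈⇒ReceiverRule (here refl)                         = fetch end
  ∈⇒ReceiverRule (there (here refl))                 = confirm end
  ∈⇒ReceiverRule (there (there (here refl)))         = fetch one
  ∈⇒ReceiverRule (there (there (there (here refl)))) = confirm one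

-- A letter held by the Receiver still counts as the head of the queue, so that `fetch` does not
-- change the simulated content.
queue : Fin 3 → Word 2 → Word 2
queue zero    u = u
queue (suc x) u = x ∷ u

queue-∷ʳ : ∀ q u {x} → queue q (u ∷ʳ x) ≡ queue q u ∷ʳ x
queue-∷ʳ zero    u = refl
queue-∷ʳ (suc _) u = refl

Accepts : List Prog → Word 2 → Set
Accepts []      w = w ≡ []
Accepts (P ∷ K) w = ∃[ w′ ] ⟦ P ⟧ w w′ × Accepts K w′

module Simulation (P₀ : Prog) where

  data Step : State → Channel → Act 2 → State → Set where
    load  : ∀ {i} → Step (load (suc i)) 𝚛 (msg one) (load i)
    ready : Step (load 0) 𝚛 (msg end) (at (P₀ ∷ []))
    skip  : ∀ {K} → Step (at (skip ∷ K)) 𝚛 ε (at K)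
    write : ∀ {x K} → Step (at (write x ∷ K)) 𝚛 (msg x) (at K)
    send  : ∀ {x K} → Step (at (read x ∷ K)) 𝚕 (msg x) (sent x K)
    full  : ∀ {x K} → Step (sent x K) 𝚕 (test N) (seen x K)
    empty : ∀ {x K} → Step (seen x K) 𝚕 (test Z) (at K)
    split : ∀ {P Q K} → Step (at (P ∙ Q ∷ K)) 𝚛 ε (at (P ∷ Q ∷ K))
    enter : ∀ {P K} → Step (at (P ⋆ ∷ K)) 𝚛 ε (at (P ∷ P ⋆ ∷ K))
    leave : ∀ {P K} → Step (at (P ⋆ ∷ K)) 𝚛 ε (at K)

  record Transition : Set where
    constructor transition
    field
      {source}  : State
      {channel} : Channel
      {action}  : Act 2
      {target}  : State
      step      : Step source channel action target

  open Transition

  -- Finitely many continuations suffice because the body of `P ⋆` returns to `P ⋆ ∷ K`, whose rules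
  -- are already listed.
  transitions : Prog → List Prog → List Transition
  transitions skip      K = transition (skip {K}) ∷ []
  transitions (write x) K = transition (write {x} {K}) ∷ []
  transitions (read x)  K =
    transition (send {x} {K}) ∷ transition (full {x} {K}) ∷ transition (empty {x} {K}) ∷ []
  transitions (P ∙ Q)   K =
    transition (split {P} {Q} {K}) ∷ transitions P (Q ∷ K) ++ transitions Q K
  transitions (P ⋆)     K =
    transition (enter {P} {K}) ∷ transition (leave {P} {K}) ∷ transitions P (P ⋆ ∷ K)

  core : List Transition
  core = transition ready ∷ transitions P₀ []

  withLoader : ℕ → List Transition
  withLoader zero    = core
  withLoader (suc i) = transition (load {i}) ∷ withLoader i

  codeTransition : Transition → ℕ
  codeTransition t =
    ⟨ number (source t) , ⟨ codeChannel (channel t) , ⟨ codeAct (action t) , number (target t) ⟩ ⟩ ⟩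

  opaque
    input : ℕ
    input = codeList codeTransition core

    input-≡ : input ≡ codeList codeTransition core
    input-≡ = refl

  -- A code is at least as large as its parts, so `input` bounds the states of `core`;
  -- `⟨ 1 , input ⟩` is the largest number of a load state.
  bound : ℕ
  bound = input + ⟨ 1 , input ⟩

  Bounded : State → Set
  Bounded σ = number σ ≤ bound

  -- The cut-off at bound only serves to define state on all of State; no state
  -- in use is affected by it.

  opaque
    state : State → Fin (suc bound)
    state σ = fromℕ< (s≤s (m⊓n≤n (number σ) bound))

    toℕ-state : ∀ {σ} → Bounded σ → toℕ (state σ) ≡ number σ
    toℕ-state {σ} b = trans (toℕ-fromℕ< (s≤s (m⊓n≤n (number σ) bound))) (m≤n⇒m⊓n≡m b)

  rule : Transition → Rule 2 (suc bound)
  rule t = state (source t) , channel t , action t , state (target t)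

  all : List Transition
  all = withLoader input

  system : UCST
  system = ucst 2 (suc bound) 3 (List.map rule all) receiverRules

  instance₀ : Instance
  instance₀ = inst system (state (load input)) (state (at [])) zero zero

  -- Bounds on the state numbers

  code-∈-< : ∀ {t ts} → t ∈ ts → codeTransition t < codeList codeTransition ts
  code-∈-< {ts = t ∷ ts} (here refl) = s≤s (x≤⟨x,y⟩ (codeTransition t) (codeList codeTransition ts))
  code-∈-< {ts = t ∷ ts} (there t∈)  =
    ≤-trans (code-∈-< t∈) (≤-trans (y≤⟨x,y⟩ (codeTransition t) _) (n≤1+n _))

  core-bounded : ∀ {t} → t ∈ core → Bounded (source t) × Bounded (target t)
  core-bounded {t} t∈ =
    ≤-trans (x≤⟨x,y⟩ (number (source t)) r₁) below ,
    ≤-trans (y≤⟨x,y⟩ (codeAct (action t)) (number (target t)))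
      (≤-trans (y≤⟨x,y⟩ (codeChannel (channel t)) r₂)
        (≤-trans (y≤⟨x,y⟩ (number (source t)) r₁) below))
    where
    r₂ = ⟨ codeAct (action t) , number (target t) ⟩
    r₁ = ⟨ codeChannel (channel t) , r₂ ⟩
    below : codeTransition t ≤ bound
    below = ≤-trans (≤-trans (<⇒≤ (code-∈-< t∈)) (≤-reflexive (sym input-≡))) (m≤m+n input _)

  load-bounded : ∀ {i} → i ≤ input → Bounded (load i)
  load-bounded i≤ = ≤-trans (⟨⟩-monoʳ-≤ 1 i≤) (m≤n+m _ input)

  withLoader-bounded : ∀ i → i ≤ input → ∀ {t} → t ∈ withLoader i →
                       Bounded (source t) × Bounded (target t)
  withLoader-bounded zero    _  t∈          = core-bounded t∈
  withLoader-bounded (suc i) i< (here refl) = load-bounded i< , load-bounded (<⇒≤ i<)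
  withLoader-bounded (suc i) i< (there t∈)  = withLoader-bounded i (<⇒≤ i<) t∈

  all-bounded : ∀ {t} → t ∈ all → Bounded (source t) × Bounded (target t)
  all-bounded = withLoader-bounded input ≤-refl

  in-class : UCST[Z₁ˡ,N₁ˡ] system
  in-class = record
    { sender-tests      = λ r∈ → let (t , _ , eq) = ∈-map⁻ rule r∈ in tests (step t) eq
    ; no-receiver-tests = λ r∈ → no-tests (∈⇒ReceiverRule r∈)
    }
    where
    no-tests : ∀ {q c R q′} → ¬ ReceiverRule (q , c , test R , q′)
    no-tests ()
    tests : ∀ {σ d α τ p c R p′} → Step σ d α τ →
            (p , c , test R , p′) ≡ (state σ , d , α , state τ) → c ≡ 𝚕 × (R ≡ Z ⊎ R ≡ N)
    tests full  refl = refl , inj₂ refl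
    tests empty refl = refl , inj₁ refl

  -- Read backwards, a run to the final configuration keeps Sound invariant.

  Sound : State → Fin 3 → Word 2 → Word 2 → Set
  Sound (load i)   q u v = v ≡ [] → ⟦ P₀ ⟧ (queue q u ++ encode (i ∷ [])) []
  Sound (at K)     q u v = v ≡ [] → Accepts K (queue q u)
  Sound (sent x K) q u v = v ≢ [] × (v ≡ x ∷ [] → ∃[ w ] queue q u ≡ x ∷ w × Accepts K w)
  Sound (seen x K) q u v = (v ≡ [] → Accepts K (queue q u)) ×
                           (v ≡ x ∷ [] → ∃[ w ] queue q u ≡ x ∷ w × Accepts K w)

  -- A Sender state of the system is only a number; it is read as the `State` with that number,
  -- unique by `number-injective`, if there is one.
  SoundConfig : Config system → Set
  SoundConfig (p , q , u , v) = ∀ σ → number σ ≡ toℕ p → Sound σ q u v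

  sender-sound : ∀ {σ c α τ q u v u′ v′} → Step σ c α τ → On (Sends α) c (u , v) (u′ , v′) →
                 Sound τ q u′ v′ → Sound σ q u v
  sender-sound {q = q} {u} (load {i}) (on-𝚛 write) s refl =
    subst (λ w → ⟦ P₀ ⟧ w [])
      (trans (cong (_++ encode (i ∷ [])) (queue-∷ʳ q u)) (++-assoc (queue q u) _ _)) (s refl)
  sender-sound {q = q} {u} ready (on-𝚛 write) s refl
    with _ , run , refl ← s refl = subst (λ w → ⟦ P₀ ⟧ w []) (queue-∷ʳ q u) run
  sender-sound skip (on-𝚛 skip) s refl = _ , refl , s refl
  sender-sound {q = q} {u} write (on-𝚛 write) s refl = _ , queue-∷ʳ q u , s refl
  sender-sound send (on-𝚕 write) s refl = proj₂ s refl
  sender-sound full (on-𝚕 (test v∈N)) s = Equivalence.to ∈N v∈N , proj₂ s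
  sender-sound empty (on-𝚕 (test v∈Z)) s with refl ← Equivalence.to ∈Z v∈Z = s , λ ()
  sender-sound split (on-𝚛 skip) s refl =
    let (_ , r , _ , r′ , acc) = s refl in _ , (_ , r , r′) , acc
  sender-sound enter (on-𝚛 skip) s refl =
    let (_ , r , _ , rs , acc) = s refl in _ , r ◅ rs , acc
  sender-sound leave (on-𝚛 skip) s refl = _ , ε , s refl

  -- A loss on the empty `𝚕` enters `sent` with `𝚕` still empty, which the component `v ≢ []` of
  -- `Sound` excludes.
  lose-sound : ∀ {σ x τ q u v} → Step σ 𝚕 (msg x) τ → Sound τ q u v → Sound σ q u v
  lose-sound send (v≢[] , _) v≡[] = contradiction v≡[] v≢[]

  fetch-sound : ∀ σ {x u v} → Sound σ (suc x) u v → Sound σ zero (x ∷ u) v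
  fetch-sound (at _)     s = s
  fetch-sound (load _)   s = s
  fetch-sound (sent _ _) s = s
  fetch-sound (seen _ _) s = s

  -- In `seen` this step is the simulated read: the letter held is the one requested. In `sent` it
  -- must not empty `𝚕`, or `full` could not fire; in `at` and `load` the claim concerns an empty
  -- `𝚕` only.
  confirm-sound : ∀ σ {x u v} → Sound σ zero u v → Sound σ (suc x) u (x ∷ v)
  confirm-sound (at _)     s       = λ ()
  confirm-sound (load _)   s       = λ ()
  confirm-sound (sent _ _) (s , _) = (λ ()) , λ { refl → contradiction refl s }
  confirm-sound (seen _ _) (s , _) = (λ ()) , λ { refl → _ , refl , s refl }

  matching : ∀ {t p p′ c α} → t ∈ all → (p , c , α , p′) ≡ rule t → ∀ σ → number σ ≡ toℕ p →
             σ ≡ source t × number (target t) ≡ toℕ p′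
  matching t∈ refl σ eq =
    let (b , b′) = all-bounded t∈
    in number-injective (trans eq (toℕ-state b)) , sym (toℕ-state b′)

  step-sound : ∀ {c c′} → WriteLossy system c c′ → SoundConfig c′ → SoundConfig c
  step-sound (reliable (sender r∈ acts)) s σ eq
    with t , t∈ , r≡ ← ∈-map⁻ rule r∈
    with refl , eq′ ← matching t∈ r≡ σ eq
    with refl ← r≡
    = sender-sound (step t) acts (s (target t) eq′)
  step-sound (reliable (receiver r∈ acts)) s σ eq with ∈⇒ReceiverRule r∈ | acts
  ... | fetch x   | on-𝚛 read = fetch-sound σ (s σ eq)
  ... | confirm x | on-𝚕 read = confirm-sound σ (s σ eq)
  step-sound (lose r∈) s σ eq
    with t , t∈ , r≡ ← ∈-map⁻ rule r∈
    with refl , eq′ ← matching t∈ r≡ σ eq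
    with refl ← r≡
    = lose-sound (step t) (s (target t) eq′)

  run-sound : ∀ {c c′} → Star (WriteLossy system) c c′ → SoundConfig c′ → SoundConfig c
  run-sound ε        s = s
  run-sound (x ◅ xs) s = step-sound x (run-sound xs s)

  reachable⇒accepts : EEReachable instance₀ → ⟦ P₀ ⟧ (encode (input ∷ [])) []
  reachable⇒accepts run =
    run-sound run final (load input) (sym (toℕ-state (load-bounded ≤-refl))) refl
    where
    final : SoundConfig (state (at []) , zero , [] , [])
    final σ eq with refl ← number-injective {σ} {at []} (trans eq (toℕ-state {at []} z≤n)) =
      λ _ → refl

  -- Completeness of the simulation

  fire : ∀ {t q u v u′ v′} → t ∈ all → On (Sends (action t)) (channel t) (u , v) (u′ , v′) →
         WriteLossy system (state (source t) , q , u , v) (state (target t) , q , u′ , v′)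
  fire t∈ acts = reliable (sender (∈-map⁺ rule t∈) acts)

  run : ∀ P {K w w′} → transitions P K ⊆ all → ⟦ P ⟧ w w′ →
        Star (WriteLossy system) (state (at (P ∷ K)) , zero , w , [])
                                 (state (at K) , zero , w′ , [])
  run skip      ⊆all refl = fire (⊆all (here refl)) (on-𝚛 skip) ◅ ε
  run (write x) ⊆all refl = fire (⊆all (here refl)) (on-𝚛 write) ◅ ε
  run (read x)  ⊆all refl =
    fire (⊆all (here refl)) (on-𝚕 write) ◅
    fire (⊆all (there (here refl))) (on-𝚕 (test (Equivalence.from ∈N λ ()))) ◅
    reliable (receiver (ReceiverRule⇒∈ (fetch x)) (on-𝚛 read)) ◅
    reliable (receiver (ReceiverRule⇒∈ (confirm x)) (on-𝚕 read)) ◅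
    fire (⊆all (there (there (here refl)))) (on-𝚕 (test (Equivalence.from ∈Z refl))) ◅ ε
  run (P ∙ Q) {K} ⊆all (_ , r , r′) =
    fire (⊆all (here refl)) (on-𝚛 skip) ◅
    run P (⊆all ∘ there ∘ ∈-++⁺ˡ) r ◅◅
    run Q (⊆all ∘ there ∘ ∈-++⁺ʳ (transitions P (Q ∷ K))) r′
  run (P ⋆) ⊆all ε = fire (⊆all (there (here refl))) (on-𝚛 skip) ◅ ε
  run (P ⋆) ⊆all (r ◅ rs) =
    fire (⊆all (here refl)) (on-𝚛 skip) ◅
    run P (⊆all ∘ there ∘ there) r ◅◅
    run (P ⋆) ⊆all rs

  core⊆withLoader : ∀ i → core ⊆ withLoader i
  core⊆withLoader zero    = id
  core⊆withLoader (suc i) = there ∘ core⊆withLoader i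

  run-load : ∀ i {u} → withLoader i ⊆ all →
             Star (WriteLossy system) (state (load i) , zero , u , [])
                                      (state (at (P₀ ∷ [])) , zero , u ++ encode (i ∷ []) , [])
  run-load zero    ⊆all = fire (⊆all (here refl)) (on-𝚛 write) ◅ ε
  run-load (suc i) {u} ⊆all =
    fire (⊆all (here refl)) (on-𝚛 write) ◅
    subst (λ w → Star (WriteLossy system) (state (load i) , zero , u ∷ʳ one , [])
                                          (state (at (P₀ ∷ [])) , zero , w , []))
      (++-assoc u (one ∷ []) (encode (i ∷ []))) (run-load i (⊆all ∘ there))

  accepts⇒reachable : ⟦ P₀ ⟧ (encode (input ∷ [])) [] → EEReachable instance₀
  accepts⇒reachable r =
    run-load input id ◅◅ run P₀ (core⊆withLoader input ∘ there) r

-- Instance codes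

-- This is the code of `withLoader i` when `core` has code `c`: 0 stands for `𝚛`, `⟨ 1 , 1 ⟩` for
-- `msg one`, and `⟨ 1 , suc i ⟩` and `⟨ 1 , i ⟩` for the two load states.
loaderCode : ℕ → ℕ → ℕ
loaderCode c zero    = c
loaderCode c (suc i) =
  suc ⟨ ⟨ ⟨ 1 , suc i ⟩ , ⟨ 0 , ⟨ ⟨ 1 , 1 ⟩ , ⟨ 1 , i ⟩ ⟩ ⟩ ⟩ , loaderCode c i ⟩

opaque
  tuple : (a b c d e f g h i : ℕ) → ℕ
  tuple a b c d e f g h i = ⟨ a , ⟨ b , ⟨ c , ⟨ d , ⟨ e , ⟨ f , ⟨ g , ⟨ h , i ⟩ ⟩ ⟩ ⟩ ⟩ ⟩ ⟩ ⟩

  codeInstance-tuple : ∀ I → let open Instance I; open UCST system in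
    codeInstance I ≡ tuple #M #Q₁ #Q₂ (codeList codeRule Δ₁) (codeList codeRule Δ₂)
                           (toℕ p-in) (toℕ p-fi) (toℕ q-in) (toℕ q-fi)
  codeInstance-tuple _ = refl

  tupleʳ : ∀ {A B C D E F G H I : Vec ℕ n → ℕ} →
           Recursive A → Recursive B → Recursive C → Recursive D → Recursive E →
           Recursive F → Recursive G → Recursive H → Recursive I →
           Recursive (λ xs → tuple (A xs) (B xs) (C xs) (D xs) (E xs) (F xs) (G xs) (H xs) (I xs))
  tupleʳ a b c d e f g h i =
    ⟨⟩ʳ a (⟨⟩ʳ b (⟨⟩ʳ c (⟨⟩ʳ d (⟨⟩ʳ e (⟨⟩ʳ f (⟨⟩ʳ g (⟨⟩ʳ h i)))))))

-- The program enters the code of its instance only through `c`, which is what closes the circle of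
-- self-reference.
selfCode : (receiver input : ℕ) → ℕ
selfCode r c = tuple 2 (suc (c + ⟨ 1 , c ⟩)) 3 (loaderCode c c) r ⟨ 1 , c ⟩ 0 0 0

selfCodeʳ : ∀ r → Recursive {1} (λ xs → selfCode r (lookup xs zero))
selfCodeʳ r = tupleʳ (constʳ 2) (sucʳ (+ʳ c initial)) (constʳ 3)
                     (comp₂ {H = λ i c → loaderCode c i} loaderʳ c c) (constʳ r) initial
                     (constʳ 0) (constʳ 0) (constʳ 0)
  where
  c : Recursive {1} (λ xs → lookup xs zero)
  c = projʳ zero
  initial : Recursive {1} (λ xs → ⟨ 1 , lookup xs zero ⟩)
  initial = ⟨⟩ʳ (constʳ 1) c

  next : Recursive {3} (λ xs → suc ⟨ ⟨ ⟨ 1 , suc (lookup xs zero) ⟩ ,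
           ⟨ 0 , ⟨ ⟨ 1 , 1 ⟩ , ⟨ 1 , lookup xs zero ⟩ ⟩ ⟩ ⟩ , lookup xs (suc zero) ⟩)
  next = sucʳ (⟨⟩ʳ (⟨⟩ʳ (⟨⟩ʳ (constʳ 1) (sucʳ (projʳ zero)))
           (⟨⟩ʳ (constʳ 0) (⟨⟩ʳ (constʳ ⟨ 1 , 1 ⟩) (⟨⟩ʳ (constʳ 1) (projʳ zero)))))
           (projʳ (suc zero)))

  loaderʳ : Recursive {2} (λ xs → loaderCode (lookup xs (suc zero)) (lookup xs zero))
  loaderʳ = prec (proj zero) (proj₁ next) , λ { (i ∷ c ∷ []) → loader⇓ i c }
    where
    loader⇓ : ∀ i c → prec (proj zero) (proj₁ next) · i ∷ c ∷ [] ⇓ loaderCode c i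
    loader⇓ zero    c = prec⇓-zero proj⇓
    loader⇓ (suc i) c = prec⇓-suc (loader⇓ i c) (proj₂ next _)

module _ (P : Prog) where
  open Simulation P
  open Transition

  withLoader-code : ∀ i → codeList codeTransition (withLoader i) ≡ loaderCode input i
  withLoader-code zero    = sym input-≡
  withLoader-code (suc i) =
    cong (λ c → suc ⟨ codeTransition (transition (load {i})) , c ⟩) (withLoader-code i)

  -- `input` had to be defined from `number`, before the states of the system, whose count depends
  -- on it. The two codes agree since no state in use is cut off.
  rules-code : ∀ {ts} → ts ⊆ all →
               codeList codeRule (List.map rule ts) ≡ codeList codeTransition ts
  rules-code {[]}     ⊆all = refl
  rules-code {t ∷ ts} ⊆all =
    cong₂ (λ c c′ → suc ⟨ c , c′ ⟩)
      (cong₂ (λ x y → ⟨ x , ⟨ codeChannel (channel t) , ⟨ codeAct (action t) , y ⟩ ⟩ ⟩)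
        (toℕ-state {source t} (proj₁ (all-bounded (⊆all (here refl)))))
        (toℕ-state {target t} (proj₂ (all-bounded (⊆all (here refl))))))
      (rules-code (⊆all ∘ there))

  code-instance₀ : codeInstance instance₀ ≡ selfCode (codeList codeRule receiverRules) input
  code-instance₀ = trans (codeInstance-tuple instance₀)
    (trans (cong₂ (λ c i → tuple 2 (suc bound) 3 c (codeList codeRule receiverRules)
                                 i (toℕ (state (at []))) 0 0)
              (trans (rules-code id) (withLoader-code input))
              (toℕ-state {load input} (load-bounded ≤-refl)))
           (cong (λ j → tuple 2 (suc bound) 3 (loaderCode input input)
                              (codeList codeRule receiverRules) ⟨ 1 , input ⟩ j 0 0)
              (toℕ-state {at []} z≤n)))

-- Diagonalization

InClass : Instance → Set
InClass I = UCST[Z₁ˡ,N₁ˡ] (Instance.system I)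

-- No excluded middle is involved: reachability would force both answers 1 and 0, so it is refuted;
-- then `f` must answer 0, which makes the final configuration reachable.
self-refuting⇒¬Decides : ∀ {f} I → InClass I →
                         (EEReachable I → f · codeInstance I ∷ [] ⇓ 0) →
                         (f · codeInstance I ∷ [] ⇓ 0 → EEReachable I) →
                         ¬ Decides f EEReach-WriteLossy InClass
self-refuting⇒¬Decides {f} I I∈ refuted reached decides = unreachable (reached rejected)
  where
  unreachable : ¬ EEReachable I
  unreachable reachable
    with () ← ⇓-deterministic (refuted reachable) (proj₁ (decides I I∈) reachable)

  rejected : f · codeInstance I ∷ [] ⇓ 0
  rejected = proj₂ (decides I I∈) unreachable

-- Here h = f ∘ selfCode, and input is the code of the rules of the system that
-- runs h, so that selfCode input is the code of that system with input loaded.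

theorem8p6 : UndecidableOn EEReach-WriteLossy (λ I → UCST[Z₁ˡ,N₁ˡ] (Instance.system I))
theorem8p6 (f , decides) =
  self-refuting⇒¬Decides instance₀ in-class refuted
    (λ d → accepts⇒reachable (complete H {δ = []} (diagonal d))) decides
  where
  self = selfCodeʳ (codeList codeRule receiverRules)

  h : Rec 1
  h = comp f (proj₁ self ∷ [])

  H = vanishing h

  open Simulation (prog H)

  diagonal : f · codeInstance instance₀ ∷ [] ⇓ 0 → h · input ∷ [] ⇓ 0
  diagonal d = comp⇓ (proj₂ self (input ∷ []) ∷ [])
                     (subst (λ c → f · c ∷ [] ⇓ 0) (code-instance₀ (prog H)) d)

  undiagonal : h · input ∷ [] ⇓ 0 → f · codeInstance instance₀ ∷ [] ⇓ 0
  undiagonal (comp⇓ (e ∷ []) d) =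
    -- The derivation of `h` passes some number to `f`; determinism identifies it with `selfCode` of
    -- `input`.
    subst (λ c → f · c ∷ [] ⇓ 0)
      (trans (⇓-deterministic e (proj₂ self (input ∷ []))) (sym (code-instance₀ (prog H)))) d

  refuted : EEReachable instance₀ → f · codeInstance instance₀ ∷ [] ⇓ 0
  refuted reachable = undiagonal (proj₁ (proj₂ (sound H (reachable⇒accepts reachable))))
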